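{- The following series identity holds: $$\sum_{k=0}^{\infty}\left(\frac{16}{27}\right)^k\frac{(1)_k^2}{(\frac{7}{6})_k(\frac{11}{6})_k}\left\{\frac{21+22k}{1+2k}H_{1+2k}^{(2)}-\frac{145+174k}{(1+2k)^3}\right\}=-120\beta(4).$$
   Context: For a complex number $x$ and a nonnegative integer $n$, the shifted factorial is $(x)_0=1$ and $(x)_n=x(x+1)\cdots(x+n-1)$ for $n\ge 1$; $(x)_n^m$ denotes $((x)_n)^m$. The harmonic numbers of order 2 are $H_n^{(2)}=\sum_{j=1}^n \frac{1}{j^2}$ for positive integers $n$. The constant $\beta(4)$ is $\beta(4)=\sum_{k=0}^{\infty}\frac{(-1)^k}{(1+2k)^4}$. -}

module Defs where

open import Algebra.Definitions.RawSemiring using ()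
open import Data.Nat.Base as ℕ using (ℕ; zero; suc; z≤n; s≤s)
import Data.Nat.Properties as ℕ
open import Data.Nat.Tactic.RingSolver using (solve-∀)
open import Data.Integer.Base as ℤ using (+_; +[1+_])
import Data.Integer.Properties as ℤ
open import Data.Product.Base using (∃-syntax; _×_; _,_)
open import Data.Rational.Base
open import Data.Rational.Properties
open import Data.Rational.Solver using (module +-*-Solver)
import Data.Rational.Unnormalised.Base as ℚᵘ
import Data.Rational.Unnormalised.Properties as ℚᵘ
open import Data.Sum.Base using (inj₁; inj₂)
open import Function.Base using (it)
open import Relation.Binary.PropositionalEquality
  using (_≡_; refl; sym; trans; cong; cong₂; subst; subst₂)

open Algebra.Definitions.RawSemiring +-*-rawSemiring using (_^_) public

∣p∣≤q : ∀ {p q} → p ≤ q → - p ≤ q → ∣ p ∣ ≤ q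
∣p∣≤q {p} p≤q -p≤q with ∣p∣≡p∨∣p∣≡-p p
... | inj₁ eq = subst (_≤ _) (sym eq) p≤q
... | inj₂ eq = subst (_≤ _) (sym eq) -p≤q

∣p-q∣≡∣q-p∣ : ∀ p q → ∣ p - q ∣ ≡ ∣ q - p ∣
∣p-q∣≡∣q-p∣ p q = trans (sym (∣-p∣≡∣p∣ (p - q))) (cong ∣_∣ (lemma p q))
  where
  open +-*-Solver
  lemma : ∀ p q → - (p - q) ≡ q - p
  lemma = solve 2 (λ p q → :- (p :- q) := q :- p) refl

∣p∣-∣q∣≤∣p-q∣ : ∀ p q → ∣ p ∣ - ∣ q ∣ ≤ ∣ p - q ∣
∣p∣-∣q∣≤∣p-q∣ p q = begin
  ∣ p ∣ - ∣ q ∣                ≡⟨ cong (λ r → ∣ r ∣ - ∣ q ∣) (l₁ p q) ⟩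
  ∣ (p - q) + q ∣ - ∣ q ∣      ≤⟨ +-monoˡ-≤ (- ∣ q ∣) (∣p+q∣≤∣p∣+∣q∣ (p - q) q) ⟩
  (∣ p - q ∣ + ∣ q ∣) - ∣ q ∣  ≡⟨ l₂ ∣ p - q ∣ ∣ q ∣ ⟩
  ∣ p - q ∣                    ∎
  where
  open ≤-Reasoning
  open +-*-Solver
  l₁ : ∀ p q → p ≡ (p - q) + q
  l₁ = solve 2 (λ p q → p := (p :- q) :+ q) refl
  l₂ : ∀ p q → (p + q) - q ≡ p
  l₂ = solve 2 (λ p q → (p :+ q) :- q := p) refl

∣∣p∣-∣q∣∣≤∣p-q∣ : ∀ p q → ∣ ∣ p ∣ - ∣ q ∣ ∣ ≤ ∣ p - q ∣
∣∣p∣-∣q∣∣≤∣p-q∣ p q = ∣p∣≤q (∣p∣-∣q∣≤∣p-q∣ p q) (begin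
  - (∣ p ∣ - ∣ q ∣)  ≡⟨ lemma ∣ p ∣ ∣ q ∣ ⟩
  ∣ q ∣ - ∣ p ∣      ≤⟨ ∣p∣-∣q∣≤∣p-q∣ q p ⟩
  ∣ q - p ∣          ≡⟨ ∣p-q∣≡∣q-p∣ q p ⟩
  ∣ p - q ∣          ∎)
  where
  open ≤-Reasoning
  open +-*-Solver
  lemma : ∀ p q → - (p - q) ≡ q - p
  lemma = solve 2 (λ p q → :- (p :- q) := q :- p) refl

toℚᵘ-/ : ∀ p q .{{_ : ℕ.NonZero q}} → toℚᵘ (+ p / q) ℚᵘ.≃ (+ p ℚᵘ./ q)
toℚᵘ-/ p (suc q) = toℚᵘ-fromℚᵘ (ℚᵘ.mkℚᵘ (+ p) q)

0<½ε : ∀ {ε} → 0ℚ < ε → 0ℚ < ½ * ε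
0<½ε {ε} 0<ε = positive⁻¹ _ {{pos*pos⇒pos ½ ε {{positive 0<ε}}}}

½ε+½ε : ∀ ε → ½ * ε + ½ * ε ≡ ε
½ε+½ε ε = trans (sym (*-distribʳ-+ ε ½ ½)) (*-identityˡ ε)

IsCauchy : (ℕ → ℚ) → Set
IsCauchy s = ∀ ε → 0ℚ < ε →
  ∃[ N ] (∀ m n → N ℕ.≤ m → N ℕ.≤ n → ∣ s m - s n ∣ < ε)

-- A real number is a Cauchy sequence of rationals; since ≡ on ℝ compares
-- representatives, real values are compared only through _<ᴿ_.
record ℝ : Set where
  constructor mkℝ
  field
    seq      : ℕ → ℚ
    isCauchy : IsCauchy seq

open ℝ public

infixl 6 _-ᴿ_
infixr 7 _•_
infix  4 _<ᴿ_

fromℚ : ℚ → ℝ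
fromℚ q = mkℝ (λ _ → q) λ ε 0<ε →
  0 , λ _ _ _ _ → subst (_< ε) (sym (cong ∣_∣ (+-inverseʳ q))) 0<ε

_-ᴿ_ : ℝ → ℝ → ℝ
x -ᴿ y = mkℝ (λ n → seq x n - seq y n) cauchy
  where
  rearrange : ∀ a b c d → (a - b) - (c - d) ≡ (a - c) - (b - d)
  rearrange = solve 4 (λ a b c d →
    (a :- b) :- (c :- d) := (a :- c) :- (b :- d)) refl
    where open +-*-Solver
  cauchy : IsCauchy (λ n → seq x n - seq y n)
  cauchy ε 0<ε with isCauchy x (½ * ε) (0<½ε 0<ε) | isCauchy y (½ * ε) (0<½ε 0<ε)
  ... | M , hx | N , hy = M ℕ.⊔ N , λ m n ≤m ≤n → begin-strict
    ∣ (seq x m - seq y m) - (seq x n - seq y n) ∣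
      ≡⟨ cong ∣_∣ (rearrange (seq x m) (seq y m) (seq x n) (seq y n)) ⟩
    ∣ (seq x m - seq x n) - (seq y m - seq y n) ∣
      ≤⟨ ∣p-q∣≤∣p∣+∣q∣ (seq x m - seq x n) (seq y m - seq y n) ⟩
    ∣ seq x m - seq x n ∣ + ∣ seq y m - seq y n ∣
      <⟨ +-mono-< (hx m n (ℕ.m⊔n≤o⇒m≤o M N ≤m) (ℕ.m⊔n≤o⇒m≤o M N ≤n))
                  (hy m n (ℕ.m⊔n≤o⇒n≤o M N ≤m) (ℕ.m⊔n≤o⇒n≤o M N ≤n)) ⟩
    ½ * ε + ½ * ε
      ≡⟨ ½ε+½ε ε ⟩
    ε ∎
    where open ≤-Reasoning

∣_∣ᴿ : ℝ → ℝ
∣ x ∣ᴿ = mkℝ (λ n → ∣ seq x n ∣) cauchy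
  where
  cauchy : IsCauchy (λ n → ∣ seq x n ∣)
  cauchy ε 0<ε with isCauchy x ε 0<ε
  ... | N , h = N , λ m n ≤m ≤n →
    ≤-<-trans (∣∣p∣-∣q∣∣≤∣p-q∣ (seq x m) (seq x n)) (h m n ≤m ≤n)

_•_ : ℚ → ℝ → ℝ
c • x = mkℝ (λ n → c * seq x n) cauchy
  where
  open ≤-Reasoning
  b : ℚ
  b = 1ℚ + ∣ c ∣
  b>0 : 0ℚ < b
  b>0 = +-mono-<-≤ (positive⁻¹ 1ℚ) (0≤∣p∣ c)
  instance
    b-pos : Positive b
    b-pos = positive b>0
    b-nonZero : NonZero b
    b-nonZero = pos⇒nonZero b
  distrib : ∀ c p q → c * p - c * q ≡ c * (p - q)
  distrib = solve 3 (λ c p q → c :* p :- c :* q := c :* (p :- q)) refl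
    where open +-*-Solver
  cauchy : IsCauchy (λ n → c * seq x n)
  cauchy ε 0<ε with isCauchy x (1/ b * ε)
    (positive⁻¹ _ {{pos*pos⇒pos (1/ b) {{1/pos⇒pos b}} ε {{positive 0<ε}}}})
  ... | N , h = N , λ m n ≤m ≤n → begin-strict
    ∣ c * seq x m - c * seq x n ∣    ≡⟨ cong ∣_∣ (distrib c (seq x m) (seq x n)) ⟩
    ∣ c * (seq x m - seq x n) ∣      ≡⟨ ∣p*q∣≡∣p∣*∣q∣ c (seq x m - seq x n) ⟩
    ∣ c ∣ * ∣ seq x m - seq x n ∣    ≤⟨ *-monoʳ-≤-nonNeg ∣ seq x m - seq x n ∣
                                          {{∣-∣-nonNeg (seq x m - seq x n)}} ∣c∣≤b ⟩
    b * ∣ seq x m - seq x n ∣        <⟨ *-monoʳ-<-pos b (h m n ≤m ≤n) ⟩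
    b * (1/ b * ε)                   ≡⟨ sym (*-assoc b (1/ b) ε) ⟩
    b * 1/ b * ε                     ≡⟨ cong (_* ε) (*-inverseʳ b) ⟩
    1ℚ * ε                           ≡⟨ *-identityˡ ε ⟩
    ε                                ∎
    where
    ∣c∣≤b : ∣ c ∣ ≤ b
    ∣c∣≤b = subst (_≤ b) (+-identityˡ ∣ c ∣)
      (+-monoˡ-≤ ∣ c ∣ (<⇒≤ (positive⁻¹ 1ℚ)))

-- The gap δ makes this independent of the representing sequences.
_<ᴿ_ : ℝ → ℝ → Set
x <ᴿ y = ∃[ δ ] (0ℚ < δ × ∃[ N ] (∀ n → N ℕ.≤ n → seq x n + δ ≤ seq y n))

_ConvergesTo_ : (ℕ → ℝ) → ℝ → Set
s ConvergesTo x = ∀ ε → 0ℚ < ε →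
  ∃[ N ] (∀ n → N ℕ.≤ n → ∣ s n -ᴿ x ∣ᴿ <ᴿ fromℚ ε)

-- Sum of the first n terms, f 0 + ⋯ + f (n - 1).
∑< : ℕ → (ℕ → ℚ) → ℚ
∑< zero    f = 0ℚ
∑< (suc n) f = ∑< n f + f n

_HasSum_ : (ℕ → ℚ) → ℝ → Set
f HasSum x = (λ n → fromℚ (∑< n f)) ConvergesTo x

-- In the Cauchy completion the sum is represented by the sequence of
-- partial sums itself; ∑∞-hasSum confirms that they converge to it.
∑∞ : (f : ℕ → ℚ) → IsCauchy (λ n → ∑< n f) → ℝ
∑∞ f = mkℝ (λ n → ∑< n f)

∑∞-hasSum : ∀ f (c : IsCauchy (λ n → ∑< n f)) → f HasSum ∑∞ f c
∑∞-hasSum f c ε 0<ε with c (½ * ε) (0<½ε 0<ε)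
... | N , h = N , λ n N≤n → ½ * ε , 0<½ε 0<ε , N , λ j N≤j →
  subst (∣ ∑< n f - ∑< j f ∣ + ½ * ε ≤_) (½ε+½ε ε)
    (+-monoˡ-≤ (½ * ε) (<⇒≤ (h n j N≤n N≤j)))

-- All parameters occurring below are rational, so ℚ is enough here.
poch : ℚ → ℕ → ℚ
poch x zero    = 1ℚ
poch x (suc n) = poch x n * (x + + n / 1)

H⁽²⁾ : ℕ → ℚ
H⁽²⁾ n = ∑< n (λ j → + 1 / suc j ℕ.^ 2)

poch-pos : ∀ x .{{_ : Positive x}} n → Positive (poch x n)
poch-pos x zero    = _
poch-pos x (suc n) = pos*pos⇒pos (poch x n) {{poch-pos x n}} (x + + n / 1)
  {{positive (+-mono-<-≤ (positive⁻¹ x)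
    (nonNegative⁻¹ (+ n / 1) {{normalize-nonNeg n 1}}))}}

private instance
  1+2k^n≢0 : ∀ {k n} → ℕ.NonZero ((1 ℕ.+ 2 ℕ.* k) ℕ.^ n)
  1+2k^n≢0 {k} {n} = ℕ.m^n≢0 (1 ℕ.+ 2 ℕ.* k) n

β4-term : ℕ → ℚ
β4-term k = (- 1ℚ) ^ k * (+ 1 / (1 ℕ.+ 2 ℕ.* k) ℕ.^ 4)

∣-1^k∣ : ∀ k → ∣ (- 1ℚ) ^ k ∣ ≡ 1ℚ
∣-1^k∣ zero    = refl
∣-1^k∣ (suc k) = trans (∣p*q∣≡∣p∣*∣q∣ (- 1ℚ) ((- 1ℚ) ^ k))
                       (trans (*-identityˡ _) (∣-1^k∣ k))

-- 1/(1+2k)⁴ is at most 2/(k+1) - 2/(k+2), so β(4) is dominated by a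
-- telescoping series.
tail : ℕ → ℚ
tail k = + 2 / suc k

telescopeℕ : ∀ k → suc k ℕ.* suc (suc k) ℕ.≤ 2 ℕ.* (1 ℕ.+ 2 ℕ.* k) ℕ.^ 4
telescopeℕ k = begin
  suc k ℕ.* suc (suc k)                       ≤⟨ ℕ.m≤m+n _ (5 ℕ.* k ℕ.+ 7 ℕ.* (k ℕ.* k)) ⟩
  suc k ℕ.* suc (suc k) ℕ.+ (5 ℕ.* k ℕ.+ 7 ℕ.* (k ℕ.* k))
                                              ≡⟨ expand k ⟩
  2 ℕ.* ((1 ℕ.+ 2 ℕ.* k) ℕ.* (1 ℕ.+ 2 ℕ.* k)) ≤⟨ ℕ.*-monoʳ-≤ 2 (square≤fourth (1 ℕ.+ 2 ℕ.* k)) ⟩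
  2 ℕ.* (1 ℕ.+ 2 ℕ.* k) ℕ.^ 4                 ∎
  where
  open ℕ.≤-Reasoning
  expand : ∀ k → suc k ℕ.* suc (suc k) ℕ.+ (5 ℕ.* k ℕ.+ 7 ℕ.* (k ℕ.* k))
                 ≡ 2 ℕ.* ((1 ℕ.+ 2 ℕ.* k) ℕ.* (1 ℕ.+ 2 ℕ.* k))
  expand = solve-∀
  square≤fourth : ∀ a .{{_ : ℕ.NonZero a}} → a ℕ.* a ℕ.≤ a ℕ.^ 4
  square≤fourth a = ℕ.*-monoʳ-≤ a (ℕ.m≤m*n a (a ℕ.* (a ℕ.* 1))
    {{ℕ.m*n≢0 a (a ℕ.* 1) {{it}} {{ℕ.m*n≢0 a 1}}}})

telescope+ : ∀ k → + 1 / (1 ℕ.+ 2 ℕ.* k) ℕ.^ 4 + tail (suc k) ≤ tail k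
telescope+ k = toℚᵘ-cancel-≤ (begin
  toℚᵘ (+ 1 / D + tail (suc k))
    ≃⟨ toℚᵘ-homo-+ (+ 1 / D) (tail (suc k)) ⟩
  toℚᵘ (+ 1 / D) ℚᵘ.+ toℚᵘ (tail (suc k))
    ≃⟨ ℚᵘ.+-cong (toℚᵘ-/ 1 D) (toℚᵘ-/ 2 (suc (suc k))) ⟩
  (+ 1 ℚᵘ./ D) ℚᵘ.+ (+ 2 ℚᵘ./ suc (suc k))
    ≤⟨ core D (telescopeℕ k) ⟩
  + 2 ℚᵘ./ suc k
    ≃⟨ ℚᵘ.≃-sym (toℚᵘ-/ 2 (suc k)) ⟩
  toℚᵘ (tail k) ∎)
  where
  open ℚᵘ.≤-Reasoning
  D : ℕ
  D = (1 ℕ.+ 2 ℕ.* k) ℕ.^ 4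
  core : ∀ d .{{_ : ℕ.NonZero d}} → suc k ℕ.* suc (suc k) ℕ.≤ 2 ℕ.* d →
         (+ 1 ℚᵘ./ d) ℚᵘ.+ (+ 2 ℚᵘ./ suc (suc k)) ℚᵘ.≤ (+ 2 ℚᵘ./ suc k)
  core d@(suc _) h = ℚᵘ.*≤* (ℤ.+≤+ ineq)
    where
    regroupˡ : ∀ k d → (1 ℕ.* suc (suc k) ℕ.+ 2 ℕ.* d) ℕ.* suc k
                       ≡ suc k ℕ.* suc (suc k) ℕ.+ 2 ℕ.* d ℕ.* suc k
    regroupˡ = solve-∀
    regroupʳ : ∀ k d → 2 ℕ.* d ℕ.+ 2 ℕ.* d ℕ.* suc k ≡ 2 ℕ.* (d ℕ.* suc (suc k))
    regroupʳ = solve-∀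
    ineq : (1 ℕ.* suc (suc k) ℕ.+ 2 ℕ.* d) ℕ.* suc k ℕ.≤ 2 ℕ.* (d ℕ.* suc (suc k))
    ineq = subst₂ ℕ._≤_ (sym (regroupˡ k d)) (regroupʳ k d)
      (ℕ.+-monoˡ-≤ (2 ℕ.* d ℕ.* suc k) h)

tail-pos : ∀ k → 0ℚ < tail k
tail-pos k = positive⁻¹ (tail k) {{normalize-pos 2 (suc k)}}

tail-antitone : ∀ {m n} → m ℕ.≤ n → tail n ≤ tail m
tail-antitone {m} {n} m≤n = toℚᵘ-cancel-≤ (begin
  toℚᵘ (tail n)    ≃⟨ toℚᵘ-/ 2 (suc n) ⟩
  + 2 ℚᵘ./ suc n   ≤⟨ ℚᵘ.*≤* (ℤ.+≤+ (ℕ.*-monoʳ-≤ 2 (s≤s m≤n))) ⟩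
  + 2 ℚᵘ./ suc m   ≃⟨ ℚᵘ.≃-sym (toℚᵘ-/ 2 (suc m)) ⟩
  toℚᵘ (tail m)    ∎)
  where open ℚᵘ.≤-Reasoning

tail→0 : ∀ ε → 0ℚ < ε → ∃[ N ] tail N < ε
tail→0 ε 0<ε with positive 0<ε
tail→0 (mkℚ +[1+ p ] q _) _ | _ = 2 ℕ.* suc q ,
  toℚᵘ-cancel-< (ℚᵘ.≤-<-trans (ℚᵘ.≤-reflexive (toℚᵘ-/ 2 (suc (2 ℕ.* suc q))))
    (ℚᵘ.*<* (ℤ.+<+ (ℕ.m≤m+n (suc (2 ℕ.* suc q)) (p ℕ.* suc (2 ℕ.* suc q))))))

β4-partial : ℕ → ℚ
β4-partial n = ∑< n β4-term

∣β4-term∣ : ∀ k → ∣ β4-term k ∣ ≤ tail k - tail (suc k)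
∣β4-term∣ k = begin
  ∣ (- 1ℚ) ^ k * t ∣              ≡⟨ ∣p*q∣≡∣p∣*∣q∣ ((- 1ℚ) ^ k) t ⟩
  ∣ (- 1ℚ) ^ k ∣ * ∣ t ∣          ≡⟨ cong₂ _*_ (∣-1^k∣ k) (0≤p⇒∣p∣≡p 0≤t) ⟩
  1ℚ * t                          ≡⟨ lemma t (tail (suc k)) ⟩
  (t + tail (suc k)) - tail (suc k)
                                  ≤⟨ +-monoˡ-≤ (- tail (suc k)) (telescope+ k) ⟩
  tail k - tail (suc k)           ∎
  where
  open ≤-Reasoning
  t : ℚ
  t = + 1 / (1 ℕ.+ 2 ℕ.* k) ℕ.^ 4
  0≤t : 0ℚ ≤ t
  0≤t = nonNegative⁻¹ t {{normalize-nonNeg 1 ((1 ℕ.+ 2 ℕ.* k) ℕ.^ 4)}}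
  lemma : ∀ t u → 1ℚ * t ≡ (t + u) - u
  lemma = solve 2 (λ t u → con 1ℚ :* t := (t :+ u) :- u) refl
    where open +-*-Solver

β4-increment : ∀ d n →
  ∣ β4-partial (d ℕ.+ n) - β4-partial n ∣ ≤ tail n - tail (d ℕ.+ n)
β4-increment zero n = ≤-reflexive (trans
  (cong ∣_∣ (+-inverseʳ (β4-partial n))) (sym (+-inverseʳ (tail n))))
β4-increment (suc d) n = begin
  ∣ (s + t) - s₀ ∣                ≡⟨ cong ∣_∣ (swap s t s₀) ⟩
  ∣ (s - s₀) + t ∣                ≤⟨ ∣p+q∣≤∣p∣+∣q∣ (s - s₀) t ⟩
  ∣ s - s₀ ∣ + ∣ t ∣              ≤⟨ +-mono-≤ (β4-increment d n) (∣β4-term∣ (d ℕ.+ n)) ⟩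
  (tail n - tail (d ℕ.+ n)) + (tail (d ℕ.+ n) - tail (suc d ℕ.+ n))
    ≡⟨ cancel (tail n) (tail (d ℕ.+ n)) (tail (suc d ℕ.+ n)) ⟩
  tail n - tail (suc d ℕ.+ n)     ∎
  where
  open ≤-Reasoning
  s s₀ t : ℚ
  s  = β4-partial (d ℕ.+ n)
  s₀ = β4-partial n
  t  = β4-term (d ℕ.+ n)
  swap : ∀ s t u → (s + t) - u ≡ (s - u) + t
  swap = solve 3 (λ s t u → (s :+ t) :- u := (s :- u) :+ t) refl
    where open +-*-Solver
  cancel : ∀ a b c → (a - b) + (b - c) ≡ a - c
  cancel = solve 3 (λ a b c → (a :- b) :+ (b :- c) := a :- c) refl
    where open +-*-Solver

β4-cauchy : IsCauchy β4-partial
β4-cauchy ε 0<ε with tail→0 ε 0<ε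
... | N , tailN<ε = N , close
  where
  open ≤-Reasoning
  ordered : ∀ {m n} → N ℕ.≤ n → n ℕ.≤ m → ∣ β4-partial m - β4-partial n ∣ < ε
  ordered {m} {n} N≤n n≤m = begin-strict
    ∣ β4-partial m - β4-partial n ∣
      ≤⟨ subst (λ k → ∣ β4-partial k - β4-partial n ∣ ≤ tail n - tail k)
               (ℕ.m∸n+n≡m n≤m) (β4-increment (m ℕ.∸ n) n) ⟩
    tail n - tail m
      ≤⟨ +-monoʳ-≤ (tail n) (neg-antimono-≤ (<⇒≤ (tail-pos m))) ⟩
    tail n + 0ℚ    ≡⟨ +-identityʳ (tail n) ⟩
    tail n         ≤⟨ tail-antitone N≤n ⟩
    tail N         <⟨ tailN<ε ⟩
    ε              ∎
  close : ∀ m n → N ℕ.≤ m → N ℕ.≤ n → ∣ β4-partial m - β4-partial n ∣ < ε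
  close m n N≤m N≤n with ℕ.≤-total n m
  ... | inj₁ n≤m = ordered N≤n n≤m
  ... | inj₂ m≤n = subst (_< ε) (∣p-q∣≡∣q-p∣ (β4-partial n) (β4-partial m)) (ordered N≤m m≤n)

β4 : ℝ
β4 = ∑∞ β4-term β4-cauchy

β4-hasSum : β4-term HasSum β4
β4-hasSum = ∑∞-hasSum β4-term β4-cauchy

summand : ℕ → ℚ
summand k =
  (+ 16 / 27) ^ k
  * (_÷_ (poch 1ℚ k ^ 2) (poch (+ 7 / 6) k * poch (+ 11 / 6) k) {{ab≢0}})
  * ( (+ (21 ℕ.+ 22 ℕ.* k) / (1 ℕ.+ 2 ℕ.* k)) * H⁽²⁾ (1 ℕ.+ 2 ℕ.* k)
    - + (145 ℕ.+ 174 ℕ.* k) / (1 ℕ.+ 2 ℕ.* k) ℕ.^ 3 )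
  where
  a = poch (+ 7 / 6) k
  b = poch (+ 11 / 6) k
  ab≢0 : NonZero (a * b)
  ab≢0 = pos⇒nonZero (a * b)
    {{pos*pos⇒pos a {{poch-pos (+ 7 / 6) k}} b {{poch-pos (+ 11 / 6) k}}}}

{-# OPTIONS --safe #-}
module Submission where

-- Put M = m + ½ and expand Σₘ (-1)ᵐ / (M² - x²) to first order in x².  Koecher's identity
--   1/(M² - x²) = Σ_{j<J} Π_{i≤j} (x² - i²) / Π_{i≤j+1} (M² - i²)
--                 + Π_{i≤J} (x² - i²)/(M² - i²) / (M² - x²)        (i ≥ 1)
-- splits off terms depending on m only through (-1)ᵐ / Π_{i≤J} (M² - i²), and this is a
-- difference in m: up to a factor depending on J it equals g J m - g J (m + 1).  Letting
-- J = 2K when m = K, the identity becomes summation along a diagonal, in which the partial sums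
-- of the series are -120 times those of β(4) plus a multiple of
-- e (2K) K = Σ_{J<2K} H_J / (J + 1)² · g (J + 1) K.
-- For fixed K, |g J K| first decreases and then increases in J, so it is bounded by its values
-- at J = 1 and J = 2K; both are O(1/K²), hence the error tends to 0.

open import Data.Integer.Base as ℤ using (+_)
import Data.Integer.Properties as ℤ
open import Data.Nat.Base as ℕ using (ℕ; zero; suc)
import Data.Nat.Properties as ℕ
open import Data.Product.Base using (∃-syntax; _,_)
open import Data.Rational.Base
open import Data.Rational.Properties
open import Data.Rational.Solver using (module +-*-Solver)
import Data.Rational.Unnormalised.Base as ℚᵘ
import Data.Rational.Unnormalised.Properties as ℚᵘ
open import Data.Sum.Base using (_⊎_; inj₁; inj₂)
open import Relation.Binary.PropositionalEquality
  using (_≡_; _≢_; refl; sym; trans; cong; cong₂; subst; subst₂; module ≡-Reasoning)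
open import Defs

open +-*-Solver using (solve; _:=_; _:+_; _:*_; _:-_; :-_; con)

-- Casting naturals to ℚ

opaque
  -- Opaque, so that `ι n` stays an atom for the ring solver instead of unfolding to a normalised
  -- fraction.
  ι : ℕ → ℚ
  ι n = + n / 1

  ι≡ : ∀ n → ι n ≡ + n / 1
  ι≡ n = refl

  /*ι : ∀ a b .{{_ : ℕ.NonZero b}} → (+ a / b) * ι b ≡ ι a
  /*ι a b@(suc b-1) = toℚᵘ-injective (begin
    toℚᵘ ((+ a / b) * (+ b / 1))          ≈⟨ toℚᵘ-homo-* (+ a / b) (+ b / 1) ⟩
    toℚᵘ (+ a / b) ℚᵘ.* toℚᵘ (+ b / 1)    ≈⟨ ℚᵘ.*-cong (toℚᵘ-/ a b) (toℚᵘ-/ b 1) ⟩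
    (+ a ℚᵘ./ b) ℚᵘ.* (+ b ℚᵘ./ 1)        ≈⟨ ℚᵘ.*≡* (trans (ℤ.*-identityʳ _)
                                              (cong (+ a ℤ.*_) (cong +_ (sym (ℕ.*-identityʳ b))))) ⟩
    + a ℚᵘ./ 1                            ≈⟨ ℚᵘ.≃-sym (toℚᵘ-/ a 1) ⟩
    toℚᵘ (+ a / 1)                        ∎)
    where open ℚᵘ.≃-Reasoning

  ι-suc : ∀ n → ι (suc n) ≡ 1ℚ + ι n
  ι-suc n = toℚᵘ-injective (begin
    toℚᵘ (+ suc n / 1)              ≈⟨ toℚᵘ-/ (suc n) 1 ⟩
    + suc n ℚᵘ./ 1
      ≈⟨ ℚᵘ.*≡* (cong (λ i → (+ 1 ℤ.+ i) ℤ.* + 1) (sym (ℤ.*-identityʳ (+ n)))) ⟩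
    ℚᵘ.1ℚᵘ ℚᵘ.+ (+ n ℚᵘ./ 1)        ≈⟨ ℚᵘ.+-congʳ ℚᵘ.1ℚᵘ (ℚᵘ.≃-sym (toℚᵘ-/ n 1)) ⟩
    toℚᵘ 1ℚ ℚᵘ.+ toℚᵘ (+ n / 1)     ≈⟨ ℚᵘ.≃-sym (toℚᵘ-homo-+ 1ℚ (+ n / 1)) ⟩
    toℚᵘ (1ℚ + + n / 1)             ∎)
    where open ℚᵘ.≃-Reasoning

  ι-injective : ∀ m n → ι m ≡ ι n → m ≡ n
  ι-injective m n eq = ℤ.+-injective (ℤ.*-cancelʳ-≡ (+ m) (+ n) (+ 1)
    (ℚᵘ.drop-*≡* (ℚᵘ.≃-trans (ℚᵘ.≃-sym (toℚᵘ-/ m 1))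
      (ℚᵘ.≃-trans (ℚᵘ.≃-reflexive (cong toℚᵘ eq)) (toℚᵘ-/ n 1)))))

  0≤ι : ∀ n → 0ℚ ≤ ι n
  0≤ι n = nonNegative⁻¹ (+ n / 1) {{normalize-nonNeg n 1}}

  ι-0 : ι 0 ≡ 0ℚ
  ι-0 = refl

ι-+ : ∀ m n → ι (m ℕ.+ n) ≡ ι m + ι n
ι-+ zero    n = sym (trans (cong (_+ ι n) ι-0) (+-identityˡ (ι n)))
ι-+ (suc m) n = begin
  ι (suc (m ℕ.+ n))     ≡⟨ ι-suc (m ℕ.+ n) ⟩
  1ℚ + ι (m ℕ.+ n)      ≡⟨ cong (λ z → 1ℚ + z) (ι-+ m n) ⟩
  1ℚ + (ι m + ι n)      ≡⟨ +-assoc 1ℚ (ι m) (ι n) ⟨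
  1ℚ + ι m + ι n        ≡⟨ cong (_+ ι n) (ι-suc m) ⟨
  ι (suc m) + ι n       ∎
  where open ≡-Reasoning

ι-* : ∀ m n → ι (m ℕ.* n) ≡ ι m * ι n
ι-* zero    n = trans ι-0 (sym (trans (cong (_* ι n) ι-0) (*-zeroˡ (ι n))))
ι-* (suc m) n = begin
  ι (n ℕ.+ m ℕ.* n)     ≡⟨ ι-+ n (m ℕ.* n) ⟩
  ι n + ι (m ℕ.* n)     ≡⟨ cong (λ z → ι n + z) (ι-* m n) ⟩
  ι n + ι m * ι n       ≡⟨ solve 2 (λ a b → b :+ a :* b := (con 1ℚ :+ a) :* b) refl (ι m) (ι n) ⟩
  (1ℚ + ι m) * ι n      ≡⟨ cong (_* ι n) (ι-suc m) ⟨
  ι (suc m) * ι n       ∎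
  where open ≡-Reasoning

-- The transparent twin of `ι`, for numerals: inside `con` they have to compute.
q : ℕ → ℚ
q n = + n / 1

-- Cancellation, nonvanishing and sign rules in ℚ

*-cancelˡ-≢0 : ∀ {a b} d → d ≢ 0ℚ → d * a ≡ d * b → a ≡ b
*-cancelˡ-≢0 {a} {b} d d≢0 eq = begin
  a               ≡⟨ *-identityˡ a ⟨
  1ℚ * a          ≡⟨ cong (_* a) (*-inverseˡ d) ⟨
  1/ d * d * a    ≡⟨ *-assoc (1/ d) d a ⟩
  1/ d * (d * a)  ≡⟨ cong (1/ d *_) eq ⟩
  1/ d * (d * b)  ≡⟨ *-assoc (1/ d) d b ⟨
  1/ d * d * b    ≡⟨ cong (_* b) (*-inverseˡ d) ⟩
  1ℚ * b          ≡⟨ *-identityˡ b ⟩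
  b               ∎
  where
  open ≡-Reasoning
  instance
    d-nonZero : NonZero d
    d-nonZero = ≢-nonZero d≢0

*-≢0 : ∀ {a b} → a ≢ 0ℚ → b ≢ 0ℚ → a * b ≢ 0ℚ
*-≢0 {a} a≢0 b≢0 ab≡0 = b≢0 (*-cancelˡ-≢0 a a≢0 (trans ab≡0 (sym (*-zeroʳ a))))

>0⇒≢0 : ∀ {p} → 0ℚ < p → p ≢ 0ℚ
>0⇒≢0 0<p p≡0 = <⇒≢ 0<p (sym p≡0)

-- Parity: otherwise the odd number `1 + 2a` would equal the even number `2b`. This keeps `d`
-- nonzero although its first factor changes sign.
odd≢0 : ∀ a b → 1ℚ + (ι a + ι a) - (ι b + ι b) ≢ 0ℚ
odd≢0 a b eq = ℕ.even≢odd b a (ι-injective (2 ℕ.* b) (suc (2 ℕ.* a)) (begin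
  ι (2 ℕ.* b)                   ≡⟨ double b ⟩
  ι b + ι b                     ≡⟨ +-identityˡ _ ⟨
  0ℚ + (ι b + ι b)              ≡⟨ cong (_+ (ι b + ι b)) eq ⟨
  1ℚ + (ι a + ι a) - (ι b + ι b) + (ι b + ι b)
    ≡⟨ solve 2 (λ x y → x :- y :+ y := x) refl (1ℚ + (ι a + ι a)) (ι b + ι b) ⟩
  1ℚ + (ι a + ι a)              ≡⟨ cong (λ z → 1ℚ + z) (double a) ⟨
  1ℚ + ι (2 ℕ.* a)              ≡⟨ ι-suc (2 ℕ.* a) ⟨
  ι (suc (2 ℕ.* a))             ∎))
  where
  open ≡-Reasoning
  double : ∀ n → ι (2 ℕ.* n) ≡ ι n + ι n
  double n = trans (cong (λ z → ι (n ℕ.+ z)) (ℕ.+-identityʳ n)) (ι-+ n n)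

0<1+ : ∀ {p} → 0ℚ ≤ p → 0ℚ < 1ℚ + p
0<1+ = +-mono-<-≤ (positive⁻¹ 1ℚ)

0≤+ : ∀ {p r} → 0ℚ ≤ p → 0ℚ ≤ r → 0ℚ ≤ p + r
0≤+ = +-mono-≤

0≤* : ∀ {p r} → 0ℚ ≤ p → 0ℚ ≤ r → 0ℚ ≤ p * r
0≤* {p} {r} 0≤p 0≤r = nonNegative⁻¹ (p * r)
  {{nonNeg*nonNeg⇒nonNeg p {{nonNegative 0≤p}} r {{nonNegative 0≤r}}}}

0<* : ∀ {p r} → 0ℚ < p → 0ℚ < r → 0ℚ < p * r
0<* {p} {r} 0<p 0<r = positive⁻¹ (p * r) {{pos*pos⇒pos p {{positive 0<p}} r {{positive 0<r}}}}

p*[1/p*r]≡r : ∀ p r .{{_ : NonZero p}} → p * (1/ p * r) ≡ r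
p*[1/p*r]≡r p r = begin
  p * (1/ p * r)    ≡⟨ *-assoc p (1/ p) r ⟨
  p * 1/ p * r      ≡⟨ cong (_* r) (*-inverseʳ p) ⟩
  1ℚ * r            ≡⟨ *-identityˡ r ⟩
  r                 ∎
  where open ≡-Reasoning

ι≢0 : ∀ n .{{_ : ℕ.NonZero n}} → ι n ≢ 0ℚ
ι≢0 (suc n) = subst (_≢ 0ℚ) (sym (ι-suc n)) (>0⇒≢0 (0<1+ (0≤ι n)))

1/ι*ι : ∀ n .{{_ : ℕ.NonZero n}} → (+ 1 / n) * ι n ≡ 1ℚ
1/ι*ι n = trans (/*ι 1 n) (ι≡ 1)

/-ι : ∀ a b .{{_ : ℕ.NonZero b}} → + a / b ≡ ι a * (+ 1 / b)
/-ι a b = *-cancelˡ-≢0 (ι b) (ι≢0 b) (begin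
  ι b * (+ a / b)            ≡⟨ *-comm (ι b) (+ a / b) ⟩
  (+ a / b) * ι b            ≡⟨ /*ι a b ⟩
  ι a                        ≡⟨ *-identityʳ (ι a) ⟨
  ι a * 1ℚ                   ≡⟨ cong (ι a *_) (1/ι*ι b) ⟨
  ι a * ((+ 1 / b) * ι b)
    ≡⟨ solve 3 (λ a r b → a :* (r :* b) := b :* (a :* r)) refl (ι a) (+ 1 / b) (ι b) ⟩
  ι b * (ι a * (+ 1 / b))    ∎)
  where open ≡-Reasoning

1/-^ : ∀ b n .{{_ : ℕ.NonZero b}} .{{_ : ℕ.NonZero (b ℕ.^ n)}} → + 1 / b ℕ.^ n ≡ (+ 1 / b) ^ n
1/-^ b n = *-cancelˡ-≢0 (ι (b ℕ.^ n)) (ι≢0 (b ℕ.^ n))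
  (trans (trans (*-comm (ι (b ℕ.^ n)) _) (1/ι*ι (b ℕ.^ n))) (sym (ι^*r^ n)))
  where
  open ≡-Reasoning
  ι^*r^ : ∀ n → ι (b ℕ.^ n) * (+ 1 / b) ^ n ≡ 1ℚ
  ι^*r^ zero    = cong (_* 1ℚ) (ι≡ 1)
  ι^*r^ (suc n) = begin
    ι (b ℕ.* b ℕ.^ n) * ((+ 1 / b) * (+ 1 / b) ^ n)
      ≡⟨ cong (_* ((+ 1 / b) * (+ 1 / b) ^ n)) (ι-* b (b ℕ.^ n)) ⟩
    ι b * ι (b ℕ.^ n) * ((+ 1 / b) * (+ 1 / b) ^ n)
      ≡⟨ solve 4 (λ x y r s → x :* y :* (r :* s)
        := (r :* x) :* (y :* s)) refl (ι b) (ι (b ℕ.^ n)) (+ 1 / b) ((+ 1 / b) ^ n) ⟩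
    (+ 1 / b) * ι b * (ι (b ℕ.^ n) * (+ 1 / b) ^ n)
      ≡⟨ cong₂ _*_ (1/ι*ι b) (ι^*r^ n) ⟩
    1ℚ * 1ℚ ≡⟨⟩
    1ℚ ∎

-- The telescoping kernel

-- This is `(1 + 2x)² - 4y²`, kept factored: each factor is shown nonzero separately, and single
-- factors cancel against those of `g-shift`.
d : ℚ → ℚ → ℚ
d x y = (1ℚ + (x + x) - (y + y)) * (1ℚ + (x + x) + (y + y))

1+2x+2y≢0 : ∀ J m → 1ℚ + (ι J + ι J) + (ι m + ι m) ≢ 0ℚ
1+2x+2y≢0 J m = >0⇒≢0 (subst (0ℚ <_) (sym (+-assoc 1ℚ (ι J + ι J) (ι m + ι m)))
  (0<1+ (0≤+ (0≤+ (0≤ι J) (0≤ι J)) (0≤+ (0≤ι m) (0≤ι m)))))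

d≢0 : ∀ J m → d (ι J) (ι m) ≢ 0ℚ
d≢0 J m = *-≢0 (odd≢0 J m) (1+2x+2y≢0 J m)

sgn : ℕ → ℚ
sgn m = (- 1ℚ) ^ m

-- g J m = ½ (-1)ᵐ Π_{j<J} (j + 1)² / ((j + ½)² - m²), with numerator and denominator scaled by 4.
opaque
  g : ℕ → ℕ → ℚ
  g zero    m = ½ * sgn m
  g (suc J) m = (1/ d (ι J) (ι m)) {{≢-nonZero (d≢0 J m)}} * (q 4 * ((1ℚ + ι J) * (1ℚ + ι J)) * g J m)

  g-zero : ∀ m → g zero m ≡ ½ * sgn m
  g-zero m = refl

  g-suc : ∀ J m → d (ι J) (ι m) * g (suc J) m ≡ q 4 * ((1ℚ + ι J) * (1ℚ + ι J)) * g J m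
  g-suc J m = p*[1/p*r]≡r (d (ι J) (ι m)) _ {{≢-nonZero (d≢0 J m)}}

sgn-suc : ∀ m → sgn (suc m) ≡ - sgn m
sgn-suc m = trans (sym (neg-distribˡ-* 1ℚ (sgn m))) (cong -_ (*-identityˡ (sgn m)))

-- The denominator in the closed form is a product of factors `j + ½ - m` and `j + ½ + m`. Replacing
-- `m` by `m + 1` moves each run of factors by one place, so only end factors survive; the leftover
-- minus sign is absorbed by `(-1)ᵐ`.
g-shift : ∀ J m → (1ℚ + (ι J + ι J) + (ι m + ι m)) * g J (suc m)
                ≡ (ι J + ι J - (1ℚ + (ι m + ι m))) * g J m
g-shift zero m rewrite g-zero (suc m) | g-zero m | sgn-suc m | ι-0 =
  solve 2 (λ s y → (con 1ℚ :+ (con 0ℚ :+ con 0ℚ) :+ (y :+ y)) :* (con ½ :* (:- s))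
    := (con 0ℚ :+ con 0ℚ :- (con 1ℚ :+ (y :+ y))) :* (con ½ :* s)) refl (sgn m) (ι m)
g-shift (suc J) m rewrite ι-suc J =
  -- Multiplying by `a` completes `c` to `d x (1ℚ + y)`, and multiplying by `b` completes the
  -- coefficient on the right to `d x y`; both are then in the form of `g-suc`.
  *-cancelˡ-≢0 (a * b) (*-≢0 a≢0 (1+2x+2y≢0 J m)) (begin
    a * b * (c * g₁′)                   ≡⟨ solve 4 (λ x y g₁′ g₁ →
      (x :+ x :- (con 1ℚ :+ (y :+ y))) :* (con 1ℚ :+ (x :+ x) :+ (y :+ y))
        :* ((con 1ℚ :+ ((con 1ℚ :+ x) :+ (con 1ℚ :+ x)) :+ (y :+ y)) :* g₁′)
      := (con 1ℚ :+ (x :+ x) :+ (y :+ y)) :*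
         ((con 1ℚ :+ (x :+ x) :- ((con 1ℚ :+ y) :+ (con 1ℚ :+ y)))
          :* (con 1ℚ :+ (x :+ x) :+ ((con 1ℚ :+ y) :+ (con 1ℚ :+ y))) :* g₁′)) refl x y g₁′ g₁ ⟩
    b * (d x (1ℚ + y) * g₁′)
      ≡⟨ cong (b *_) (subst (λ z → d x z * g₁′ ≡ q 4 * (u * u) * g J (suc m)) (ι-suc m)
        (g-suc J (suc m))) ⟩
    b * (q 4 * (u * u) * g J (suc m))
      ≡⟨ solve 3 (λ b u g → b :* (con (q 4) :* (u :* u) :* g)
        := con (q 4) :* (u :* u) :* (b :* g)) refl b u (g J (suc m)) ⟩
    q 4 * (u * u) * (b * g J (suc m))   ≡⟨ cong (q 4 * (u * u) *_) (g-shift J m) ⟩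
    q 4 * (u * u) * (a * g J m)
      ≡⟨ solve 3 (λ a u g → con (q 4) :* (u :* u) :* (a :* g)
        := a :* (con (q 4) :* (u :* u) :* g)) refl a u (g J m) ⟩
    a * (q 4 * (u * u) * g J m)         ≡⟨ cong (a *_) (g-suc J m) ⟨
    a * (d x y * g₁)
      ≡⟨ solve 4 (λ x y a g → a :*
        ((con 1ℚ :+ (x :+ x) :- (y :+ y)) :* (con 1ℚ :+ (x :+ x) :+ (y :+ y)) :* g)
        := a :* (con 1ℚ :+ (x :+ x) :+ (y :+ y)) :*
          ((con 1ℚ :+ x :+ (con 1ℚ :+ x) :- (con 1ℚ :+ (y :+ y))) :* g))
          refl x y a g₁ ⟩
    a * b * ((u + u - (1ℚ + (y + y))) * g₁)  ∎)
  where
  open ≡-Reasoning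
  x = ι J
  y = ι m
  u = 1ℚ + x
  a = x + x - (1ℚ + (y + y))
  b = 1ℚ + (x + x) + (y + y)
  c = 1ℚ + (u + u) + (y + y)
  g₁′ = g (suc J) (suc m)
  g₁ = g (suc J) m
  a≢0 : a ≢ 0ℚ
  a≢0 = subst (_≢ 0ℚ) (trans (cong (λ z → 1ℚ + (x + x) - (z + z)) (ι-suc m))
    (solve 2 (λ x y → con 1ℚ :+ (x :+ x) :- (con 1ℚ :+ y :+ (con 1ℚ :+ y))
      := x :+ x :- (con 1ℚ :+ (y :+ y))) refl x y))
    (odd≢0 J (suc m))

-- The increment of the harmonic numbers: `H⁽²⁾ (suc L)` unfolds to `H⁽²⁾ L + h L`.
h : ℕ → ℚ
h j = + 1 / suc j ℕ.^ 2

h*[1+j]² : ∀ j → h j * ((1ℚ + ι j) * (1ℚ + ι j)) ≡ 1ℚ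
h*[1+j]² j = begin
  h j * ((1ℚ + ι j) * (1ℚ + ι j))  ≡⟨ cong (h j *_) (cong₂ _*_ (ι-suc j) (ι-suc j)) ⟨
  h j * (ι (suc j) * ι (suc j))    ≡⟨ cong (h j *_) (ι-* (suc j) (suc j)) ⟨
  h j * ι (suc j ℕ.* suc j)        ≡⟨ cong (λ n → h j * ι (suc j ℕ.* n)) (ℕ.*-identityʳ (suc j)) ⟨
  h j * ι (suc j ℕ.^ 2)            ≡⟨ /*ι 1 (suc j ℕ.^ 2) ⟩
  ι 1                              ≡⟨ ι≡ 1 ⟩
  1ℚ                               ∎
  where open ≡-Reasoning

ρ : ℕ → ℚ
ρ m = + 1 / (1 ℕ.+ 2 ℕ.* m)

ι-odd : ∀ m → ι (1 ℕ.+ 2 ℕ.* m) ≡ 1ℚ + (ι m + ι m)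
ι-odd m = trans (ι-suc (2 ℕ.* m)) (cong (λ z → 1ℚ + z)
  (trans (cong (λ n → ι (m ℕ.+ n)) (ℕ.+-identityʳ m)) (ι-+ m m)))

ρ*[1+2m] : ∀ m → ρ m * (1ℚ + (ι m + ι m)) ≡ 1ℚ
ρ*[1+2m] m = trans (cong (ρ m *_) (sym (ι-odd m))) (trans (/*ι 1 (1 ℕ.+ 2 ℕ.* m)) (ι≡ 1))

-- In closed form w J m = (-1)ᵐ Π_{1≤j≤J} j² / (j² - (m + ½)²); see w-zero and w-suc.
w : ℕ → ℕ → ℚ
w J m = g J m - g J (suc m)

w-zero : ∀ m → w 0 m ≡ sgn m
w-zero m rewrite g-zero m | g-zero (suc m) | sgn-suc m =
  solve 1 (λ s → con ½ :* s :- con ½ :* (:- s) := s) refl (sgn m)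

-- By `g-shift` both terms of `w` are multiples of `g J m`; their coefficients `1 + 2J + 2m` and
-- `2J - 1 - 2m` differ by `2 (1 + 2m)`, free of `J`.
w≡g : ∀ J m → (1ℚ + (ι J + ι J) + (ι m + ι m)) * w J m ≡ q 2 * (1ℚ + (ι m + ι m)) * g J m
w≡g J m = begin
  b * (g J m - g J (suc m))
    ≡⟨ solve 3 (λ b g g′ → b :* (g :- g′) := b :* g :- b :* g′) refl b (g J m) (g J (suc m)) ⟩
  b * g J m - b * g J (suc m)      ≡⟨ cong (λ z → b * g J m - z) (g-shift J m) ⟩
  b * g J m - (ι J + ι J - (1ℚ + (ι m + ι m))) * g J m
    ≡⟨ solve 3 (λ x y g → (con 1ℚ :+ (x :+ x) :+ (y :+ y)) :* g :- (x :+ x :- (con 1ℚ :+ (y :+ y))) :* g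
         := con (q 2) :* (con 1ℚ :+ (y :+ y)) :* g) refl (ι J) (ι m) (g J m) ⟩
  q 2 * (1ℚ + (ι m + ι m)) * g J m ∎
  where
  open ≡-Reasoning
  b = 1ℚ + (ι J + ι J) + (ι m + ι m)

-- Here `4 (J + 1)² - (1 + 2m)²` splits into `c`, which is a factor of `d`, and the coefficient of
-- `w (suc J) m` in `w≡g`. Trading `w` for `g` and back reduces the claim to `g-suc`.
w-suc : ∀ J m → q 4 * ((1ℚ + ι J) * (1ℚ + ι J)) * w J m
  ≡ (q 4 * ((1ℚ + ι J) * (1ℚ + ι J)) - (1ℚ + (ι m + ι m)) * (1ℚ + (ι m + ι m))) * w (suc J) m
w-suc J m = sym (*-cancelˡ-≢0 b (1+2x+2y≢0 J m) (begin
  b * ((q 4 * (u * u) - v * v) * w′)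
    ≡⟨ solve 3 (λ x y w′ → let u = con 1ℚ :+ x ; v = con 1ℚ :+ (y :+ y) in
         (con 1ℚ :+ (x :+ x) :+ (y :+ y)) :* ((con (q 4) :* (u :* u) :- v :* v) :* w′)
         := (con 1ℚ :+ (x :+ x) :+ (y :+ y)) :* (con 1ℚ :+ (x :+ x) :- (y :+ y))
            :* ((con 1ℚ :+ (u :+ u) :+ (y :+ y)) :* w′)) refl x y w′ ⟩
  b * c * ((1ℚ + (u + u) + (y + y)) * w′)
    ≡⟨ cong (b * c *_) (subst (λ z → (1ℚ + (z + z) + (y + y)) * w′ ≡ q 2 * v * g (suc J) m)
      (ι-suc J) (w≡g (suc J) m)) ⟩
  b * c * (q 2 * v * g (suc J) m)
    ≡⟨ solve 4 (λ b c v g → b :* c :* (con (q 2) :* v :* g)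
      := con (q 2) :* v :* (c :* b :* g)) refl b c v (g (suc J) m) ⟩
  q 2 * v * (d x y * g (suc J) m)
    ≡⟨ cong (q 2 * v *_) (g-suc J m) ⟩
  q 2 * v * (q 4 * (u * u) * g J m)
    ≡⟨ solve 3 (λ u v g → con (q 2) :* v :* (con (q 4) :* (u :* u) :* g)
      := con (q 4) :* (u :* u) :* (con (q 2) :* v :* g)) refl u v (g J m) ⟩
  q 4 * (u * u) * (q 2 * v * g J m)
    ≡⟨ cong (q 4 * (u * u) *_) (w≡g J m) ⟨
  q 4 * (u * u) * (b * w J m)
    ≡⟨ solve 3 (λ u b w → con (q 4) :* (u :* u) :* (b :* w)
      := b :* (con (q 4) :* (u :* u) :* w)) refl u b (w J m) ⟩
  b * (q 4 * (u * u) * w J m) ∎))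
  where
  open ≡-Reasoning
  x = ι J
  y = ι m
  u = 1ℚ + x
  v = 1ℚ + (y + y)
  b = 1ℚ + (x + x) + (y + y)
  c = 1ℚ + (x + x) - (y + y)
  w′ = w (suc J) m

-- Coefficient of x² in (-1)ᵐ Π_{i≤L} (x² - i²)/(M² - i²) / (M² - x²); note that 4 (ρ m)² = 1/M².
F : ℕ → ℕ → ℚ
F L m = w L m * (q 16 * (ρ m * ρ m) * (ρ m * ρ m) - H⁽²⁾ L * (q 4 * (ρ m * ρ m)))

-- One step of Koecher's identity at order x²: consecutive remainders differ by the term with
-- `j = L`. The factor `H⁽²⁾ L` comes from differentiating its numerator in x², and `h L` from the
-- extra `(L + 1)²` contained in `w (suc L) m`.
F-suc : ∀ L m → F (suc L) m - F L m ≡ - (H⁽²⁾ L * h L * w (suc L) m)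
F-suc L m = begin
  w′ * (q 16 * r2 * r2 - (H + hL) * (q 4 * r2)) - w L m * (q 16 * r2 * r2 - H * (q 4 * r2))
    ≡⟨ cong (λ z → w′ * (q 16 * r2 * r2 - (H + hL) * (q 4 * r2)) - z *
      (q 16 * r2 * r2 - H * (q 4 * r2))) w≡ ⟩
  w′ * (q 16 * r2 * r2 - (H + hL) * (q 4 * r2)) - w′ * (1ℚ - ¼ * hL * (v * v)) *
    (q 16 * r2 * r2 - H * (q 4 * r2))
    -- Each `v` is paired with an `r`, as `r * v` is 1; the second summand then carries
    -- `(r * v)² - 1` and vanishes.
    ≡⟨ solve 5 (λ w′ r H hL v →
         w′ :* (con (q 16) :* (r :* r) :* (r :* r) :- (H :+ hL) :* (con (q 4) :* (r :* r)))
           :- w′ :* (con 1ℚ :- con ¼ :* hL :* (v :* v)) :*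
             (con (q 16) :* (r :* r) :* (r :* r) :- H :* (con (q 4) :* (r :* r)))
         := :- (H :* hL :* w′ :* ((r :* v) :* (r :* v))) :+ con (q 4) :* hL :* w′ :* (r :* r) :*
           ((r :* v) :* (r :* v) :- con 1ℚ))
         refl w′ r H hL v ⟩
  - (H * hL * w′ * ((r * v) * (r * v))) + q 4 * hL * w′ * r2 * ((r * v) * (r * v) - 1ℚ)
    ≡⟨ cong (λ z → - (H * hL * w′ * (z * z)) + q 4 * hL * w′ * r2 * (z * z - 1ℚ)) (ρ*[1+2m] m) ⟩
  - (H * hL * w′ * (1ℚ * 1ℚ)) + q 4 * hL * w′ * r2 * (1ℚ * 1ℚ - 1ℚ)
    ≡⟨ solve 4 (λ w′ r2 H hL → :- (H :* hL :* w′ :* (con 1ℚ :* con 1ℚ)) :+ con (q 4) :* hL :* w′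
      :* r2 :* (con 1ℚ :* con 1ℚ :- con 1ℚ)
         := :- (H :* hL :* w′)) refl w′ r2 H hL ⟩
  - (H * hL * w′) ∎
  where
  open ≡-Reasoning
  ¼ = + 1 / 4
  w′ = w (suc L) m
  r = ρ m
  r2 = r * r
  H = H⁽²⁾ L
  hL = h L
  u = 1ℚ + ι L
  v = 1ℚ + (ι m + ι m)
  w≡ : w L m ≡ w′ * (1ℚ - ¼ * hL * (v * v))
  w≡ = begin
    w L m                          ≡⟨ *-identityˡ (w L m) ⟨
    1ℚ * w L m                     ≡⟨ cong (_* w L m) (h*[1+j]² L) ⟨
    hL * (u * u) * w L m
      ≡⟨ solve 3 (λ h u w → h :* (u :* u) :* w
        := con ¼ :* h :* (con (q 4) :* (u :* u) :* w)) refl hL u (w L m) ⟩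
    ¼ * hL * (q 4 * (u * u) * w L m) ≡⟨ cong (¼ * hL *_) (w-suc L m) ⟩
    ¼ * hL * ((q 4 * (u * u) - v * v) * w′)
      ≡⟨ solve 4 (λ h u v w → con ¼ :* h :* ((con (q 4) :* (u :* u) :- v :* v) :* w)
           := w :* (h :* (u :* u) :- con ¼ :* h :* (v :* v))) refl hL u v w′ ⟩
    w′ * (hL * (u * u) - ¼ * hL * (v * v)) ≡⟨ cong (λ z → w′ * (z - ¼ * hL * (v * v))) (h*[1+j]² L) ⟩
    w′ * (1ℚ - ¼ * hL * (v * v)) ∎

-- Summation along the diagonal

e : ℕ → ℕ → ℚ
e L m = ∑< L (λ J → H⁽²⁾ J * h J * g (suc J) m)

-- `F-suc` summed over `J < L`: each `w (suc J) m` is a difference in `m`, so the whole change from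
-- `F 0 m` to `F L m` is a difference of values of `e L`.
e-shift : ∀ L m → e L (suc m) + F 0 m ≡ e L m + F L m
e-shift zero    m = refl
e-shift (suc L) m = begin
  e L (suc m) + c * g′ + F 0 m
    ≡⟨ solve 3 (λ a b c → a :+ b :+ c := a :+ c :+ b) refl (e L (suc m)) (c * g′) (F 0 m) ⟩
  e L (suc m) + F 0 m + c * g′     ≡⟨ cong (_+ c * g′) (e-shift L m) ⟩
  e L m + F L m + c * g′
    ≡⟨ solve 5 (λ e F c g g′ → e :+ F :+ c :* g′
      := e :+ c :* g :+ (F :+ (:- (c :* (g :- g′))))) refl (e L m) (F L m) c g₀ g′ ⟩
  e L m + c * g₀ + (F L m + - (c * (g₀ - g′)))
    ≡⟨ cong (λ z → e L m + c * g₀ + (F L m + z)) (F-suc L m) ⟨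
  e L m + c * g₀ + (F L m + (F (suc L) m - F L m))
    ≡⟨ solve 3 (λ a f f′ → a :+ (f :+ (f′ :- f))
      := a :+ f′) refl (e L m + c * g₀) (F L m) (F (suc L) m) ⟩
  e L m + c * g₀ + F (suc L) m     ∎
  where
  open ≡-Reasoning
  c = H⁽²⁾ L * h L
  g₀ = g (suc L) m
  g′ = g (suc L) (suc m)

-- The contribution of the diagonal step from `(2k, k)` to `(2k + 2, k + 1)`: the remainder `F` for
-- raising `m`, then the two new terms of `e`. Writing `k ℕ.* 2` lets `suc k ℕ.* 2` reduce to
-- `suc (suc (k ℕ.* 2))`.
u : ℕ → ℚ
u k = F L k + H⁽²⁾ L * h L * g (suc L) (suc k) + H⁽²⁾ (suc L) * h (suc L) * g (suc (suc L)) (suc k)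
  where L = k ℕ.* 2

-- In each step `e-shift` turns `e L K + F L K` into `e L (suc K) + F 0 K`: the second part extends
-- the sum of `F 0`, and the first becomes the new `e` once `t₁` and `t₂` are added.
∑u : ∀ K → ∑< K u ≡ ∑< K (F 0) + e (K ℕ.* 2) K
∑u zero = refl
∑u (suc K) = begin
  ∑< K u + (F L K + t₁ + t₂)                          ≡⟨ cong (_+ (F L K + t₁ + t₂)) (∑u K) ⟩
  ∑< K (F 0) + e L K + (F L K + t₁ + t₂)
    ≡⟨ solve 5 (λ s e F a b → s :+ e :+ (F :+ a :+ b)
      := s :+ (e :+ F) :+ a :+ b) refl (∑< K (F 0)) (e L K) (F L K) t₁ t₂ ⟩
  ∑< K (F 0) + (e L K + F L K) + t₁ + t₂
    ≡⟨ cong (λ z → ∑< K (F 0) + z + t₁ + t₂) (e-shift L K) ⟨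
  ∑< K (F 0) + (e L (suc K) + F 0 K) + t₁ + t₂
    ≡⟨ solve 5 (λ s e F a b → s :+ (e :+ F) :+ a :+ b
      := s :+ F :+ (e :+ a :+ b)) refl (∑< K (F 0)) (e L (suc K)) (F 0 K) t₁ t₂ ⟩
  ∑< K (F 0) + F 0 K + (e L (suc K) + t₁ + t₂)        ∎
  where
  open ≡-Reasoning
  L = K ℕ.* 2
  t₁ = H⁽²⁾ L * h L * g (suc L) (suc K)
  t₂ = H⁽²⁾ (suc L) * h (suc L) * g (suc (suc L)) (suc K)

F0≡β4 : ∀ m → F 0 m ≡ q 16 * β4-term m
F0≡β4 m = begin
  w 0 m * (q 16 * (r * r) * (r * r) - 0ℚ * (q 4 * (r * r)))
    ≡⟨ cong (_* (q 16 * (r * r) * (r * r) - 0ℚ * (q 4 * (r * r)))) (w-zero m) ⟩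
  sgn m * (q 16 * (r * r) * (r * r) - 0ℚ * (q 4 * (r * r)))
    ≡⟨ solve 2 (λ s r → s :* (con (q 16) :* (r :* r) :* (r :* r) :- con 0ℚ :* (con (q 4) :* (r :* r)))
      := con (q 16) :* (s :* (r :* (r :* (r :* (r :* con 1ℚ)))))) refl (sgn m) r ⟩
  q 16 * (sgn m * (r * (r * (r * (r * 1ℚ)))))
    ≡⟨ cong (λ z → q 16 * (sgn m * z)) (1/-^ (1 ℕ.+ 2 ℕ.* m) 4 {{_}} {{ℕ.m^n≢0 (1 ℕ.+ 2 ℕ.* m) 4}}) ⟨
  q 16 * β4-term m                                           ∎
  where
  open ≡-Reasoning
  r = ρ m

-- Identification with the summand

ι-double : ∀ k → ι (k ℕ.* 2) ≡ ι k + ι k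
ι-double k = trans (cong ι (ℕ.*-comm k 2)) (trans (cong (λ n → ι (k ℕ.+ n)) (ℕ.+-identityʳ k)) (ι-+ k k))

-- The hypergeometric weight of the summand, up to a quadratic factor in k: see P≡γ.
γ : ℕ → ℚ
γ k = g (k ℕ.* 2) k

-- Six times `1/6 + y` and `5/6 + y`. At `y + 1` these are, up to the 6, the factors by which the
-- shifted factorials of `7/6` and `11/6` grow.
1+6_ 5+6_ : ℚ → ℚ
1+6 y = 1ℚ + q 6 * y
5+6 y = q 5 + q 6 * y

1+6≢0 : ∀ k → 1+6 ι k ≢ 0ℚ
1+6≢0 k = >0⇒≢0 (0<1+ (0≤* {q 6} (nonNegative⁻¹ (q 6)) (0≤ι k)))

5+6≢0 : ∀ k → 5+6 ι k ≢ 0ℚ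
5+6≢0 k = >0⇒≢0 (+-mono-<-≤ {0ℚ} {q 5} (positive⁻¹ (q 5)) (0≤* {q 6} (nonNegative⁻¹ (q 6)) (0≤ι k)))

1+2≢0 : ∀ k → 1ℚ + (ι k + ι k) ≢ 0ℚ
1+2≢0 k = >0⇒≢0 (0<1+ (0≤+ (0≤ι k) (0≤ι k)))

w-diag : ∀ k → 1+6 ι k * w (k ℕ.* 2) k ≡ q 2 * (1ℚ + (ι k + ι k)) * γ k
w-diag k = trans
  (solve 2 (λ y w → (con 1ℚ :+ con (q 6) :* y) :* w
    := (con 1ℚ :+ ((y :+ y) :+ (y :+ y)) :+ (y :+ y)) :* w) refl (ι k) (w (k ℕ.* 2) k))
  (subst (λ z → (1ℚ + (z + z) + (ι k + ι k)) * w (k ℕ.* 2) k ≡ q 2 * (1ℚ + (ι k + ι k)) * γ k)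
    (ι-double k) (w≡g (k ℕ.* 2) k))

-- From `(2k, k)`, raise `m` by `g-shift` and then `J` by `g-suc`. There `d` is
-- `3 (2k - 1) (2k + 1)`, and `2k - 1` cancels against the same factor in `g-shift`.
g₁-diag : ∀ k → q 3 * 1+6 ι k * g (suc (k ℕ.* 2)) (suc k) ≡ q 4 * (1ℚ + (ι k + ι k)) * γ k
g₁-diag k = *-cancelˡ-≢0 (v * c) (*-≢0 (1+2≢0 k) c≢0) (begin
  v * c * (q 3 * 1+6 y * g₁)
    ≡⟨ solve 2 (λ y g₁ → (con 1ℚ :+ (y :+ y)) :* (y :+ y :+ (y :+ y) :- (con 1ℚ :+ (y :+ y))) :*
      (con (q 3) :* (con 1ℚ :+ con (q 6) :* y) :* g₁)
       := (con 1ℚ :+ con (q 6) :* y) :*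
         ((con 1ℚ :+ ((y :+ y) :+ (y :+ y)) :- ((con 1ℚ :+ y) :+ (con 1ℚ :+ y))) :*
           (con 1ℚ :+ ((y :+ y) :+ (y :+ y)) :+ ((con 1ℚ :+ y) :+ (con 1ℚ :+ y))) :* g₁))
         refl y g₁ ⟩
  1+6 y * (d (y + y) (1ℚ + y) * g₁)
    ≡⟨ cong (1+6 y *_) (subst₂ (λ x z → d x z * g₁ ≡ q 4 * ((1ℚ + x) * (1ℚ + x)) * g₀′) (ι-double k)
      (ι-suc k) (g-suc (k ℕ.* 2) (suc k))) ⟩
  1+6 y * (q 4 * (v * v) * g₀′)
    ≡⟨ solve 2 (λ y g → (con 1ℚ :+ con (q 6) :* y) :*
      (con (q 4) :* ((con 1ℚ :+ (y :+ y)) :* (con 1ℚ :+ (y :+ y))) :* g)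
       := con (q 4) :* ((con 1ℚ :+ (y :+ y)) :* (con 1ℚ :+ (y :+ y))) :*
         ((con 1ℚ :+ ((y :+ y) :+ (y :+ y)) :+ (y :+ y)) :* g))
         refl y g₀′ ⟩
  q 4 * (v * v) * ((1ℚ + ((y + y) + (y + y)) + (y + y)) * g₀′)
    ≡⟨ cong (q 4 * (v * v) *_)
      (subst (λ x → (1ℚ + (x + x) + (y + y)) * g₀′ ≡ (x + x - v) * γ k) (ι-double k)
        (g-shift (k ℕ.* 2) k)) ⟩
  q 4 * (v * v) * (c * γ k)
    ≡⟨ solve 3 (λ v c g → con (q 4) :* (v :* v) :* (c :* g)
      := v :* c :* (con (q 4) :* v :* g)) refl v c (γ k) ⟩
  v * c * (q 4 * v * γ k) ∎)
  where
  open ≡-Reasoning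
  y = ι k
  v = 1ℚ + (y + y)
  c = y + y + (y + y) - v
  g₀′ = g (k ℕ.* 2) (suc k)
  g₁ = g (suc (k ℕ.* 2)) (suc k)
  c≢0 : c ≢ 0ℚ
  c≢0 = subst (_≢ 0ℚ) (trans (cong₂ (λ z z′ → 1ℚ + (z + z) - (z′ + z′)) (ι-double k) (ι-suc k))
    (solve 1 (λ y → con 1ℚ :+ (y :+ y :+ (y :+ y)) :- (con 1ℚ :+ y :+ (con 1ℚ :+ y))
      := y :+ y :+ (y :+ y) :- (con 1ℚ :+ (y :+ y))) refl y))
    (odd≢0 (k ℕ.* 2) (suc k))

-- Raises `J` once more after `g₁-diag`, where `d` is `(2k + 1) (6k + 5)`. The limiting ratio
-- `64 / (3 · 36)` is the `16/27` of the series.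
γ-suc : ∀ k → q 3 * (1+6 ι k * 5+6 ι k) * γ (suc k) ≡ q 64 * ((1ℚ + ι k) * (1ℚ + ι k)) * γ k
γ-suc k = *-cancelˡ-≢0 v (1+2≢0 k) (begin
  v * (q 3 * (1+6 y * 5+6 y) * g₂)
    ≡⟨ solve 2 (λ y g₂ → (con 1ℚ :+ (y :+ y)) :*
      (con (q 3) :* ((con 1ℚ :+ con (q 6) :* y) :* (con (q 5) :+ con (q 6) :* y)) :* g₂)
       := con (q 3) :* (con 1ℚ :+ con (q 6) :* y) :*
         ((con 1ℚ :+ ((con 1ℚ :+ (y :+ y)) :+ (con 1ℚ :+ (y :+ y))) :- ((con 1ℚ :+ y) :+ (con 1ℚ :+ y)))
           :* (con 1ℚ :+ ((con 1ℚ :+ (y :+ y)) :+ (con 1ℚ :+ (y :+ y))) :+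
             ((con 1ℚ :+ y) :+ (con 1ℚ :+ y))) :* g₂))
             refl y g₂ ⟩
  q 3 * 1+6 y * (d v (1ℚ + y) * g₂)
    ≡⟨ cong (q 3 * 1+6 y *_)
      (subst₂ (λ x z → d x z * g₂ ≡ q 4 * ((1ℚ + x) * (1ℚ + x)) * g₁) ι-1+L (ι-suc k)
        (g-suc (suc (k ℕ.* 2)) (suc k))) ⟩
  q 3 * 1+6 y * (q 4 * ((1ℚ + v) * (1ℚ + v)) * g₁)
    ≡⟨ solve 3 (λ a v g → con (q 3) :* a :* (con (q 4) :* ((con 1ℚ :+ v) :* (con 1ℚ :+ v)) :* g)
       := con (q 4) :* ((con 1ℚ :+ v) :* (con 1ℚ :+ v)) :* (con (q 3) :* a :* g)) refl (1+6 y) v g₁ ⟩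
  q 4 * ((1ℚ + v) * (1ℚ + v)) * (q 3 * 1+6 y * g₁)
    ≡⟨ cong (q 4 * ((1ℚ + v) * (1ℚ + v)) *_) (g₁-diag k) ⟩
  q 4 * ((1ℚ + v) * (1ℚ + v)) * (q 4 * v * γ k)
    ≡⟨ solve 2 (λ y g → let v = con 1ℚ :+ (y :+ y) in con (q 4) :* ((con 1ℚ :+ v) :* (con 1ℚ :+ v))
      :* (con (q 4) :* v :* g)
        := v :* (con (q 64) :* ((con 1ℚ :+ y) :* (con 1ℚ :+ y)) :* g)) refl y (γ k) ⟩
  v * (q 64 * ((1ℚ + y) * (1ℚ + y)) * γ k) ∎)
  where
  open ≡-Reasoning
  y = ι k
  v = 1ℚ + (y + y)
  g₁ = g (suc (k ℕ.* 2)) (suc k)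
  g₂ = γ (suc k)
  ι-1+L : ι (suc (k ℕ.* 2)) ≡ v
  ι-1+L = trans (ι-suc (k ℕ.* 2)) (cong (λ z → 1ℚ + z) (ι-double k))

a b : ℕ → ℚ
a k = poch (+ 7 / 6) k
b k = poch (+ 11 / 6) k

0<ab : ∀ k → 0ℚ < a k * b k
0<ab k = 0<* (positive⁻¹ (a k) {{poch-pos (+ 7 / 6) k}}) (positive⁻¹ (b k) {{poch-pos (+ 11 / 6) k}})

ab-nonZero : ∀ k → NonZero (a k * b k)
ab-nonZero k = ≢-nonZero (>0⇒≢0 (0<ab k))

P : ℕ → ℚ
P k = (+ 16 / 27) ^ k * _÷_ (poch 1ℚ k ^ 2) (a k * b k) {{ab-nonZero k}}

P*ab : ∀ k → a k * b k * P k ≡ (+ 16 / 27) ^ k * poch 1ℚ k ^ 2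
P*ab k = trans
  (solve 4 (λ m s c i → m :* (s :* (c :* i))
    := m :* (i :* (s :* c)))
      refl (a k * b k) ((+ 16 / 27) ^ k) (poch 1ℚ k ^ 2) ((1/ (a k * b k)) {{ab-nonZero k}}))
  (p*[1/p*r]≡r (a k * b k) ((+ 16 / 27) ^ k * poch 1ℚ k ^ 2) {{ab-nonZero k}})

P-suc : ∀ k → (+ 7 / 6 + ι k) * (+ 11 / 6 + ι k) * P (suc k) ≡ + 16 / 27 * ((1ℚ + ι k) * (1ℚ + ι k))
  * P k
P-suc k = *-cancelˡ-≢0 (a k * b k) (>0⇒≢0 (0<ab k)) (begin
  a k * b k * ((+ 7 / 6 + y) * (+ 11 / 6 + y) * P (suc k))
    ≡⟨ solve 5 (λ a b c d p → a :* b :* (c :* d :* p)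
      := a :* c :* (b :* d) :* p) refl (a k) (b k) (+ 7 / 6 + y) (+ 11 / 6 + y) (P (suc k)) ⟩
  a k * (+ 7 / 6 + y) * (b k * (+ 11 / 6 + y)) * P (suc k)
    ≡⟨ cong (λ z → a k * (+ 7 / 6 + z) * (b k * (+ 11 / 6 + z)) * P (suc k)) (ι≡ k) ⟩
  a (suc k) * b (suc k) * P (suc k)
    ≡⟨ P*ab (suc k) ⟩
  + 16 / 27 * (+ 16 / 27) ^ k * (poch 1ℚ k * (1ℚ + + k / 1)) ^ 2
    ≡⟨ cong (λ z → + 16 / 27 * (+ 16 / 27) ^ k * (poch 1ℚ k * (1ℚ + z)) ^ 2) (ι≡ k) ⟨
  + 16 / 27 * (+ 16 / 27) ^ k * (poch 1ℚ k * (1ℚ + y)) ^ 2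
    ≡⟨ solve 4 (λ s t c u → s :* t :* (c :* u :* (c :* u :* con 1ℚ))
      := s :* (u :* u) :* (t :* (c :* (c :* con 1ℚ)))) refl
         (+ 16 / 27) ((+ 16 / 27) ^ k) (poch 1ℚ k) (1ℚ + y) ⟩
  + 16 / 27 * ((1ℚ + y) * (1ℚ + y)) * ((+ 16 / 27) ^ k * poch 1ℚ k ^ 2)
    ≡⟨ cong (+ 16 / 27 * ((1ℚ + y) * (1ℚ + y)) *_) (P*ab k) ⟨
  + 16 / 27 * ((1ℚ + y) * (1ℚ + y)) * (a k * b k * P k)
    ≡⟨ solve 4 (λ s u m p → s :* (u :* u) :* (m :* p)
      := m :* (s :* (u :* u) :* p)) refl (+ 16 / 27) (1ℚ + y) (a k * b k) (P k) ⟩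
  a k * b k * (+ 16 / 27 * ((1ℚ + y) * (1ℚ + y)) * P k) ∎)
  where
  open ≡-Reasoning
  y = ι k

-- Both sides have the same term ratio, by `P-suc` and `γ-suc`. The constant 10 is fixed at `k = 0`,
-- where the left side is 5 and `γ 0` is ½.
P≡γ : ∀ k → 1+6 ι k * 5+6 ι k * P k ≡ q 10 * γ k
P≡γ zero = trans (cong (λ z → 1+6 z * 5+6 z * P 0) ι-0) (sym (cong (q 10 *_) (g-zero 0)))
P≡γ (suc k) = trans (cong (λ z → 1+6 z * 5+6 z * P (suc k)) (ι-suc k))
  (*-cancelˡ-≢0 B (*-≢0 (1+6≢0 k) (5+6≢0 k)) (begin
    B * (1+6 (1ℚ + y) * 5+6 (1ℚ + y) * P (suc k))
      ≡⟨ solve 3 (λ B y p → B :*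
        ((con 1ℚ :+ con (q 6) :* (con 1ℚ :+ y)) :* (con (q 5) :+ con (q 6) :* (con 1ℚ :+ y)) :* p)
           := con (q 36) :* B :* ((con (+ 7 / 6) :+ y) :* (con (+ 11 / 6) :+ y) :* p))
             refl B y (P (suc k)) ⟩
    q 36 * B * ((+ 7 / 6 + y) * (+ 11 / 6 + y) * P (suc k))
      ≡⟨ cong (q 36 * B *_) (P-suc k) ⟩
    q 36 * B * (+ 16 / 27 * ((1ℚ + y) * (1ℚ + y)) * P k)
      ≡⟨ solve 3 (λ B y p → con (q 36) :* B :* (con (+ 16 / 27) :* ((con 1ℚ :+ y) :* (con 1ℚ :+ y)) :* p)
           := con (+ 64 / 3) :* ((con 1ℚ :+ y) :* (con 1ℚ :+ y)) :* (B :* p)) refl B y (P k) ⟩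
    + 64 / 3 * ((1ℚ + y) * (1ℚ + y)) * (B * P k)
      ≡⟨ cong (+ 64 / 3 * ((1ℚ + y) * (1ℚ + y)) *_) (P≡γ k) ⟩
    + 64 / 3 * ((1ℚ + y) * (1ℚ + y)) * (q 10 * γ k)
      ≡⟨ solve 2 (λ u g → con (+ 64 / 3) :* (u :* u) :* (con (q 10) :* g)
        := con (+ 10 / 3) :* (con (q 64) :* (u :* u) :* g)) refl (1ℚ + y) (γ k) ⟩
    + 10 / 3 * (q 64 * ((1ℚ + y) * (1ℚ + y)) * γ k)
      ≡⟨ cong (+ 10 / 3 *_) (γ-suc k) ⟨
    + 10 / 3 * (q 3 * B * γ (suc k))
      ≡⟨ solve 2 (λ B g → con (+ 10 / 3) :* (con (q 3) :* B :* g)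
        := B :* (con (q 10) :* g)) refl B (γ (suc k)) ⟩
    B * (q 10 * γ (suc k)) ∎))
  where
  open ≡-Reasoning
  y = ι k
  B = 1+6 y * 5+6 y

h-diag : ∀ k → h (k ℕ.* 2) ≡ ρ k * ρ k
h-diag k = *-cancelˡ-≢0 (v * v) (*-≢0 (1+2≢0 k) (1+2≢0 k)) (begin
  v * v * h (k ℕ.* 2)    ≡⟨ *-comm (v * v) (h (k ℕ.* 2)) ⟩
  h (k ℕ.* 2) * (v * v)
    ≡⟨ subst (λ x → h (k ℕ.* 2) * ((1ℚ + x) * (1ℚ + x)) ≡ 1ℚ) (ι-double k) (h*[1+j]² (k ℕ.* 2)) ⟩
  1ℚ * 1ℚ                ≡⟨ cong₂ _*_ (ρ*[1+2m] k) (ρ*[1+2m] k) ⟨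
  ρ k * v * (ρ k * v)    ≡⟨ solve 2 (λ r v → r :* v :* (r :* v) := v :* v :* (r :* r)) refl (ρ k) v ⟩
  v * v * (ρ k * ρ k)    ∎)
  where
  open ≡-Reasoning
  v = 1ℚ + (ι k + ι k)

bracket : ℕ → ℚ
bracket k = (q 21 + q 22 * ι k) * ρ k * H⁽²⁾ (suc (k ℕ.* 2)) - (q 145 + q 174 * ι k) * (ρ k * ρ k * ρ k)

-- The diagonal lemmas turn all three terms of `u k` into multiples of `γ k`, and `H` is replaced by
-- `H′`, the harmonic number of the theorem. Its coefficient is then `-20 (5 + 6k) + 16 (1 + 2k) =
-- -4 (21 + 22k)`, and the part free of it has `116 (5 + 6k) = 4 (145 + 174k)`.
u≡bracket : ∀ k → q 3 * (1+6 ι k * 5+6 ι k) * u k ≡ - (q 4 * γ k * bracket k)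
u≡bracket k = begin
  q 3 * (A * B) * (w L k * (q 16 * (r * r) * (r * r) - H * (q 4 * (r * r))) + H * h L * g₁ + H′ * h
    (suc L) * g₂)
    ≡⟨ solve 10 (λ A B w r H hL g₁ H′ h′ g₂ →
         con (q 3) :* (A :* B) :*
           (w :* (con (q 16) :* (r :* r) :* (r :* r) :- H :* (con (q 4) :* (r :* r))) :+ H :* hL
             :* g₁ :+ H′ :* h′ :* g₂)
         := con (q 12) :* B :* (r :* r) :* (con (q 4) :* (r :* r) :- H) :* (A :* w)
            :+ B :* H :* hL :* (con (q 3) :* A :* g₁) :+ H′ :* h′ :* (con (q 3) :* (A :* B) :* g₂))
         refl A B (w L k) r H (h L) g₁ H′ (h (suc L)) g₂ ⟩
  q 12 * B * (r * r) * (q 4 * (r * r) - H) * (A * w L k)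
    + B * H * h L * (q 3 * A * g₁) + H′ * h (suc L) * (q 3 * (A * B) * g₂)
    ≡⟨ cong₂ (λ s t → q 12 * B * (r * r) * (q 4 * (r * r) - H) * s + B * H * h L * t + H′ * h
      (suc L) * (q 3 * (A * B) * g₂))
         (w-diag k) (g₁-diag k) ⟩
  q 12 * B * (r * r) * (q 4 * (r * r) - H) * (q 2 * v * γ k)
    + B * H * h L * (q 4 * v * γ k) + H′ * h (suc L) * (q 3 * (A * B) * g₂)
    ≡⟨ cong₂ (λ s t → q 12 * B * (r * r) * (q 4 * (r * r) - H) * (q 2 * v * γ k) + B * H * s *
      (q 4 * v * γ k) + H′ * h (suc L) * t)
         (h-diag k) (γ-suc k) ⟩
  q 12 * B * (r * r) * (q 4 * (r * r) - H) * (q 2 * v * γ k)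
    + B * H * (r * r) * (q 4 * v * γ k) + H′ * h (suc L) * (q 64 * ((1ℚ + y) * (1ℚ + y)) * γ k)
    ≡⟨ cong (λ H → q 12 * B * (r * r) * (q 4 * (r * r) - H) * (q 2 * v * γ k)
         + B * H * (r * r) * (q 4 * v * γ k) + H′ * h (suc L) *
           (q 64 * ((1ℚ + y) * (1ℚ + y)) * γ k)) H≡ ⟩
  q 12 * B * (r * r) * (q 4 * (r * r) - (H′ - r * r)) * (q 2 * v * γ k)
    + B * (H′ - r * r) * (r * r) * (q 4 * v * γ k) + H′ * h (suc L) *
      (q 64 * ((1ℚ + y) * (1ℚ + y)) * γ k)
    ≡⟨ solve 6 (λ r H′ y v g h′ → let B = con (q 5) :+ con (q 6) :* y in
         con (q 12) :* B :* (r :* r) :* (con (q 4) :* (r :* r) :- (H′ :- r :* r)) :*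
           (con (q 2) :* v :* g)
         :+ B :* (H′ :- r :* r) :* (r :* r) :* (con (q 4) :* v :* g) :+ H′ :* h′ :*
           (con (q 64) :* ((con 1ℚ :+ y) :* (con 1ℚ :+ y)) :* g)
         := (con (q 116) :* B :* (r :* r :* r) :- con (q 20) :* B :* r :* H′) :* g :* (r :* v)
            :+ con (q 16) :* H′ :* g :* (h′ :* ((con (q 2) :+ (y :+ y)) :* (con (q 2) :+ (y :+ y)))))
         refl r H′ y v (γ k) (h (suc L)) ⟩
  (q 116 * B * (r * r * r) - q 20 * B * r * H′) * γ k * (r * v)
    + q 16 * H′ * γ k * (h (suc L) * ((q 2 + (y + y)) * (q 2 + (y + y))))
    -- The 1 supplied by `h₂` is rewritten as `r * v`, giving the last term the factor `r` that the
    -- other `H′` term has.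
    ≡⟨ cong₂ (λ s t → (q 116 * B * (r * r * r) - q 20 * B * r * H′) * γ k * s + q 16 * H′ * γ k * t)
         (ρ*[1+2m] k) (trans h₂ (sym (ρ*[1+2m] k))) ⟩
  (q 116 * B * (r * r * r) - q 20 * B * r * H′) * γ k * 1ℚ + q 16 * H′ * γ k * (r * v)
    ≡⟨ solve 4 (λ r H′ y g → let B = con (q 5) :+ con (q 6) :* y in
         (con (q 116) :* B :* (r :* r :* r) :- con (q 20) :* B :* r :* H′) :* g :* con 1ℚ :+ con
           (q 16) :* H′ :* g :* (r :* (con 1ℚ :+ (y :+ y)))
         := :- (con (q 4) :* g :*
           ((con (q 21) :+ con (q 22) :* y) :* r :* H′ :- (con (q 145) :+ con (q 174) :* y) :*
             (r :* r :* r))))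
         refl r H′ y (γ k) ⟩
  - (q 4 * γ k * bracket k) ∎
  where
  open ≡-Reasoning
  y = ι k
  v = 1ℚ + (y + y)
  A = 1+6 y
  B = 5+6 y
  L = k ℕ.* 2
  r = ρ k
  H = H⁽²⁾ L
  H′ = H⁽²⁾ (suc L)
  g₁ = g (suc L) (suc k)
  g₂ = g (suc (suc L)) (suc k)
  H≡ : H ≡ H′ - r * r
  H≡ = trans (solve 2 (λ H s → H := H :+ s :- s) refl H (h L)) (cong (λ z → H′ - z) (h-diag k))
  h₂ : h (suc L) * ((q 2 + (y + y)) * (q 2 + (y + y))) ≡ 1ℚ
  h₂ = subst (λ x → h (suc L) * (x * x) ≡ 1ℚ)
    (trans (cong (λ z → 1ℚ + z) (trans (ι-suc L) (cong (λ z → 1ℚ + z) (ι-double k))))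
      (solve 1 (λ y → con 1ℚ :+ (con 1ℚ :+ (y :+ y)) := con (q 2) :+ (y :+ y)) refl y))
    (h*[1+j]² (suc L))

ι-affine : ∀ m n k → ι (m ℕ.+ n ℕ.* k) ≡ q m + q n * ι k
ι-affine m n k = trans (ι-+ m (n ℕ.* k)) (cong₂ _+_ (ι≡ m) (trans (ι-* n k) (cong (_* ι k) (ι≡ n))))

summand≡bracket : ∀ k → summand k ≡ P k * bracket k
summand≡bracket k = cong (P k *_) (cong₂ _-_
  (cong₂ _*_
    (trans (/-ι (21 ℕ.+ 22 ℕ.* k) (1 ℕ.+ 2 ℕ.* k)) (cong (_* ρ k) (ι-affine 21 22 k)))
    (cong (λ n → H⁽²⁾ (suc n)) (ℕ.*-comm 2 k)))
  (trans (/-ι (145 ℕ.+ 174 ℕ.* k) ((1 ℕ.+ 2 ℕ.* k) ℕ.^ 3) {{ℕ.m^n≢0 (1 ℕ.+ 2 ℕ.* k) 3}})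
    (cong₂ _*_ (ι-affine 145 174 k)
      (trans (1/-^ (1 ℕ.+ 2 ℕ.* k) 3 {{_}} {{ℕ.m^n≢0 (1 ℕ.+ 2 ℕ.* k) 3}})
        (solve 1 (λ r → r :* (r :* (r :* con 1ℚ)) := r :* r :* r) refl (ρ k))))))

-- The constant is `10 · 3 / (-4)`, from `P≡γ` and `u≡bracket`; times the 16 of `F0≡β4` it gives
-- -120.
summand≡u : ∀ k → summand k ≡ - (+ 15 / 2) * u k
summand≡u k = *-cancelˡ-≢0 B (*-≢0 (1+6≢0 k) (5+6≢0 k)) (begin
  B * summand k                        ≡⟨ cong (B *_) (summand≡bracket k) ⟩
  B * (P k * bracket k)                ≡⟨ *-assoc B (P k) (bracket k) ⟨
  B * P k * bracket k                  ≡⟨ cong (_* bracket k) (P≡γ k) ⟩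
  q 10 * γ k * bracket k
    ≡⟨ solve 2 (λ g t → con (q 10) :* g :* t
      := con (- (+ 5 / 2)) :* (:- (con (q 4) :* g :* t))) refl (γ k) (bracket k) ⟩
  - (+ 5 / 2) * - (q 4 * γ k * bracket k)  ≡⟨ cong (- (+ 5 / 2) *_) (u≡bracket k) ⟨
  - (+ 5 / 2) * (q 3 * B * u k)
    ≡⟨ solve 2 (λ B u → con (- (+ 5 / 2)) :* (con (q 3) :* B :* u)
      := B :* (con (- (+ 15 / 2)) :* u)) refl B (u k) ⟩
  B * (- (+ 15 / 2) * u k)             ∎)
  where
  open ≡-Reasoning
  B = 1+6 ι k * 5+6 ι k

-- Vanishing of the error term

*-monoˡ-≤ : ∀ {r a b} → 0ℚ ≤ r → a ≤ b → r * a ≤ r * b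
*-monoˡ-≤ {r} 0≤r = *-monoˡ-≤-nonNeg r {{nonNegative 0≤r}}

*-monoʳ-≤ : ∀ {r a b} → 0ℚ ≤ r → a ≤ b → a * r ≤ b * r
*-monoʳ-≤ {r} 0≤r = *-monoʳ-≤-nonNeg r {{nonNegative 0≤r}}

*-cancelˡ-≤ : ∀ {r a b} → 0ℚ < r → r * a ≤ r * b → a ≤ b
*-cancelˡ-≤ {r} 0<r = *-cancelˡ-≤-pos r {{positive 0<r}}

p≤p+q : ∀ {p r} → 0ℚ ≤ r → p ≤ p + r
p≤p+q {p} {r} 0≤r = subst (_≤ p + r) (+-identityʳ p) (+-monoʳ-≤ p 0≤r)

p≤q+p : ∀ {p r} → 0ℚ ≤ r → p ≤ r + p
p≤q+p {p} {r} 0≤r = subst (p ≤_) (+-comm p r) (p≤p+q 0≤r)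

≡+⇒≤ : ∀ {p r} s → 0ℚ ≤ s → r ≡ p + s → p ≤ r
≡+⇒≤ {p} s 0≤s eq = subst (p ≤_) (sym eq) (p≤p+q 0≤s)

0≤q : ∀ n → 0ℚ ≤ q n
0≤q n = nonNegative⁻¹ (q n) {{normalize-nonNeg n 1}}

p≤∣p∣ : ∀ p → p ≤ ∣ p ∣
p≤∣p∣ p with ≤-total 0ℚ p
... | inj₁ 0≤p = ≤-reflexive (sym (0≤p⇒∣p∣≡p 0≤p))
... | inj₂ p≤0 = ≤-trans p≤0 (0≤∣p∣ p)

ι-mono-≤ : ∀ {m n} → m ℕ.≤ n → ι m ≤ ι n
ι-mono-≤ {m} {n} m≤n = subst (ι m ≤_) (trans (sym (ι-+ m (n ℕ.∸ m))) (cong ι (ℕ.m+[n∸m]≡n m≤n)))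
  (p≤p+q (0≤ι (n ℕ.∸ m)))

0≤h : ∀ j → 0ℚ ≤ h j
0≤h j = nonNegative⁻¹ (h j) {{normalize-nonNeg 1 (suc j ℕ.^ 2)}}

1≤[1+j]² : ∀ j → 1ℚ ≤ (1ℚ + ι j) * (1ℚ + ι j)
1≤[1+j]² j = ≡+⇒≤ (q 2 * ι j + ι j * ι j) (0≤+ (0≤* (0≤q 2) (0≤ι j)) (0≤* (0≤ι j) (0≤ι j)))
  (solve 1 (λ x → (con 1ℚ :+ x) :* (con 1ℚ :+ x) := con 1ℚ :+ (con (q 2) :* x :+ x :* x)) refl (ι j))

h≤1 : ∀ j → h j ≤ 1ℚ
h≤1 j = subst₂ _≤_ (*-identityʳ (h j)) (h*[1+j]² j) (*-monoˡ-≤ (0≤h j) (1≤[1+j]² j))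

0≤H : ∀ n → 0ℚ ≤ H⁽²⁾ n
0≤H zero    = ≤-refl
0≤H (suc n) = 0≤+ (0≤H n) (0≤h n)

H≤ι : ∀ n → H⁽²⁾ n ≤ ι n
H≤ι zero    = 0≤ι 0
H≤ι (suc n) = subst (H⁽²⁾ (suc n) ≤_) (trans (+-comm (ι n) 1ℚ) (sym (ι-suc n)))
  (+-mono-≤ (H≤ι n) (h≤1 n))

-- A crude bound suffices for the coefficients of `e`, since the decay comes from `g`.
H*h≤1 : ∀ j → H⁽²⁾ j * h j ≤ 1ℚ
H*h≤1 j = begin
  H⁽²⁾ j * h j                      ≤⟨ *-monoʳ-≤ (0≤h j) (H≤ι j) ⟩
  ι j * h j                         ≡⟨ *-comm (ι j) (h j) ⟩
  h j * ι j
    ≤⟨ *-monoˡ-≤ (0≤h j) (≡+⇒≤ (1ℚ + ι j + ι j * ι j) (0≤+ (<⇒≤ (0<1+ (0≤ι j))) (0≤* (0≤ι j) (0≤ι j)))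
      (solve 1 (λ x → (con 1ℚ :+ x) :* (con 1ℚ :+ x) := x :+ (con 1ℚ :+ x :+ x :* x)) refl (ι j))) ⟩
  h j * ((1ℚ + ι j) * (1ℚ + ι j))   ≡⟨ h*[1+j]² j ⟩
  1ℚ                                ∎
  where open ≤-Reasoning

∣e∣≤ : ∀ {B} L m → (∀ J → J ℕ.< L → ∣ g (suc J) m ∣ ≤ B) → ∣ e L m ∣ ≤ ι L * B
∣e∣≤ {B} zero    m bound = ≤-reflexive (sym (trans (cong (_* B) ι-0) (*-zeroˡ B)))
∣e∣≤ {B} (suc L) m bound = begin
  ∣ e L m + c * g (suc L) m ∣         ≤⟨ ∣p+q∣≤∣p∣+∣q∣ (e L m) (c * g (suc L) m) ⟩
  ∣ e L m ∣ + ∣ c * g (suc L) m ∣     ≤⟨ +-mono-≤ (∣e∣≤ L m (λ J J<L → bound J (ℕ.m<n⇒m<1+n J<L))) term ⟩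
  ι L * B + 1ℚ * B
    ≡⟨ solve 2 (λ x b → x :* b :+ con 1ℚ :* b := (con 1ℚ :+ x) :* b) refl (ι L) B ⟩
  (1ℚ + ι L) * B                      ≡⟨ cong (_* B) (ι-suc L) ⟨
  ι (suc L) * B                       ∎
  where
  open ≤-Reasoning
  c = H⁽²⁾ L * h L
  0≤c : 0ℚ ≤ c
  0≤c = 0≤* (0≤H L) (0≤h L)
  term : ∣ c * g (suc L) m ∣ ≤ 1ℚ * B
  term = begin
    ∣ c * g (suc L) m ∣       ≡⟨ ∣p*q∣≡∣p∣*∣q∣ c (g (suc L) m) ⟩
    ∣ c ∣ * ∣ g (suc L) m ∣   ≡⟨ cong (_* ∣ g (suc L) m ∣) (0≤p⇒∣p∣≡p 0≤c) ⟩
    c * ∣ g (suc L) m ∣       ≤⟨ *-monoʳ-≤ (0≤∣p∣ (g (suc L) m)) (H*h≤1 L) ⟩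
    1ℚ * ∣ g (suc L) m ∣      ≤⟨ *-monoˡ-≤ {1ℚ} (<⇒≤ (positive⁻¹ 1ℚ)) (bound L ℕ.≤-refl) ⟩
    1ℚ * B                    ∎

-- The shape of `∣ g J m ∣` as a function of `J`

c : ℕ → ℚ
c J = q 4 * ((1ℚ + ι J) * (1ℚ + ι J))

0<c : ∀ J → 0ℚ < c J
0<c J = 0<* {q 4} (positive⁻¹ (q 4)) (0<* (0<1+ (0≤ι J)) (0<1+ (0≤ι J)))

∣d∣ : ℕ → ℕ → ℚ
∣d∣ J m = ∣ d (ι J) (ι m) ∣

0<∣d∣ : ∀ J m → 0ℚ < ∣d∣ J m
0<∣d∣ J m = ≰⇒> λ ∣d∣≤0 → d≢0 J m (∣p∣≡0⇒p≡0 _ (≤-antisym ∣d∣≤0 (0≤∣p∣ _)))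

∣g-suc∣ : ∀ J m → ∣d∣ J m * ∣ g (suc J) m ∣ ≡ c J * ∣ g J m ∣
∣g-suc∣ J m = begin
  ∣d∣ J m * ∣ g (suc J) m ∣            ≡⟨ ∣p*q∣≡∣p∣*∣q∣ (d (ι J) (ι m)) (g (suc J) m) ⟨
  ∣ d (ι J) (ι m) * g (suc J) m ∣      ≡⟨ cong ∣_∣ (g-suc J m) ⟩
  ∣ c J * g J m ∣                      ≡⟨ ∣p*q∣≡∣p∣*∣q∣ (c J) (g J m) ⟩
  ∣ c J ∣ * ∣ g J m ∣                  ≡⟨ cong (_* ∣ g J m ∣) (0≤p⇒∣p∣≡p (<⇒≤ (0<c J))) ⟩
  c J * ∣ g J m ∣                      ∎
  where open ≡-Reasoning

g-up : ∀ J m → ∣d∣ J m ≤ c J → ∣ g J m ∣ ≤ ∣ g (suc J) m ∣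
g-up J m d≤c = *-cancelˡ-≤ (0<c J) (begin
  c J * ∣ g J m ∣             ≡⟨ ∣g-suc∣ J m ⟨
  ∣d∣ J m * ∣ g (suc J) m ∣   ≤⟨ *-monoʳ-≤ (0≤∣p∣ (g (suc J) m)) d≤c ⟩
  c J * ∣ g (suc J) m ∣       ∎)
  where open ≤-Reasoning

g-down : ∀ J m → c J ≤ ∣d∣ J m → ∣ g (suc J) m ∣ ≤ ∣ g J m ∣
g-down J m c≤d = *-cancelˡ-≤ (0<∣d∣ J m) (begin
  ∣d∣ J m * ∣ g (suc J) m ∣   ≡⟨ ∣g-suc∣ J m ⟩
  c J * ∣ g J m ∣             ≤⟨ *-monoʳ-≤ (0≤∣p∣ (g J m)) c≤d ⟩
  ∣d∣ J m * ∣ g J m ∣         ∎)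
  where open ≤-Reasoning

-- In general `c - d` is `3 + 4J + 4m²`, which settles one sign. For the other, `- d` is
-- `4m² - (1 + 2J)²`, which falls as `J` grows while `c` rises. Hence once `∣ g J m ∣` stops
-- decreasing it never decreases again.
d≤c-suc : ∀ J m → ∣d∣ J m ≤ c J → ∣d∣ (suc J) m ≤ c (suc J)
d≤c-suc J m d≤c = subst (λ x′ → ∣ d x′ y ∣ ≤ q 4 * ((1ℚ + x′) * (1ℚ + x′))) (sym (ι-suc J))
  (∣p∣≤q
    (≡+⇒≤ (q 7 + q 4 * x + q 4 * (y * y))
      (0≤+ (0≤+ (0≤q 7) (0≤* (0≤q 4) 0≤x)) (0≤* (0≤q 4) (0≤* (0≤ι m) (0≤ι m))))
      (solve 2 (λ x y → let x′ = con 1ℚ :+ x in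
        con (q 4) :* ((con 1ℚ :+ x′) :* (con 1ℚ :+ x′))
        := (con 1ℚ :+ (x′ :+ x′) :- (y :+ y)) :* (con 1ℚ :+ (x′ :+ x′) :+ (y :+ y)) :+
          (con (q 7) :+ con (q 4) :* x :+ con (q 4) :* (y :* y)))
        refl x y))
    (begin
      - d (1ℚ + x) y                          ≤⟨ ≡+⇒≤ (q 8 + q 8 * x) (0≤+ (0≤q 8) (0≤* (0≤q 8) 0≤x))
        (solve 2 (λ x y → let x′ = con 1ℚ :+ x in
          :- ((con 1ℚ :+ (x :+ x) :- (y :+ y)) :* (con 1ℚ :+ (x :+ x) :+ (y :+ y)))
          := :- ((con 1ℚ :+ (x′ :+ x′) :- (y :+ y)) :* (con 1ℚ :+ (x′ :+ x′) :+ (y :+ y))) :+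
            (con (q 8) :+ con (q 8) :* x))
            refl x y) ⟩
      - d x y                                 ≤⟨ p≤∣p∣ (- d x y) ⟩
      ∣ - d x y ∣                             ≡⟨ ∣-p∣≡∣p∣ (d x y) ⟩
      ∣ d x y ∣                               ≤⟨ d≤c ⟩
      c J                                     ≤⟨ ≡+⇒≤ (q 12 + q 8 * x) (0≤+ (0≤q 12) (0≤* (0≤q 8) 0≤x))
        (solve 1 (λ x → con (q 4) :* ((con 1ℚ :+ (con 1ℚ :+ x)) :* (con 1ℚ :+ (con 1ℚ :+ x)))
          := con (q 4) :* ((con 1ℚ :+ x) :* (con 1ℚ :+ x)) :+ (con (q 12) :+ con (q 8) :* x)) refl x) ⟩
      q 4 * ((1ℚ + (1ℚ + x)) * (1ℚ + (1ℚ + x))) ∎))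
  where
  open ≤-Reasoning
  x = ι J
  y = ι m
  0≤x = 0≤ι J

g-climb : ∀ n J m → ∣d∣ J m ≤ c J → ∣ g J m ∣ ≤ ∣ g (n ℕ.+ J) m ∣
g-climb zero    J m d≤c = ≤-refl
g-climb (suc n) J m d≤c = ≤-trans (g-climb n J m d≤c) (g-up (n ℕ.+ J) m (d≤c-+ n))
  where
  d≤c-+ : ∀ n → ∣d∣ (n ℕ.+ J) m ≤ c (n ℕ.+ J)
  d≤c-+ zero    = d≤c
  d≤c-+ (suc n) = d≤c-suc (n ℕ.+ J) m (d≤c-+ n)

-- Either the descent from `g 1 m` is still going on, or the turning point has been passed for good.
-- It starts at 1 because `∣ g 0 m ∣` is ½ and does not decay in `m`.
g-valley : ∀ J m → ∣ g (suc J) m ∣ ≤ ∣ g 1 m ∣ ⊎ ∣d∣ (suc J) m ≤ c (suc J)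
g-valley zero    m = inj₁ ≤-refl
g-valley (suc J) m with ≤-total (∣d∣ (suc J) m) (c (suc J)) | g-valley J m
... | inj₁ d≤c | _        = inj₂ (d≤c-suc (suc J) m d≤c)
... | inj₂ _   | inj₂ d≤c = inj₂ (d≤c-suc (suc J) m d≤c)
... | inj₂ c≤d | inj₁ g≤  = inj₁ (≤-trans (g-down (suc J) m c≤d) g≤)

∣g∣≤ends : ∀ L m J → J ℕ.< L → ∣ g (suc J) m ∣ ≤ ∣ g 1 m ∣ + ∣ g L m ∣
∣g∣≤ends L m J J<L with g-valley J m
... | inj₁ g≤  = ≤-trans g≤ (p≤p+q (0≤∣p∣ (g L m)))
... | inj₂ d≤c = ≤-trans
  (subst (λ n → ∣ g (suc J) m ∣ ≤ ∣ g n m ∣) (ℕ.m∸n+n≡m J<L) (g-climb (L ℕ.∸ suc J) (suc J) m d≤c))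
  (p≤q+p (0≤∣p∣ (g 1 m)))

-- For a positive index `n`, `- d` at `J = 0` is `4n² - 1`, which is at least `n²`; the 2 is `c 0`
-- times ½.
m²*∣g₁∣≤2 : ∀ m → ι (suc m) * ι (suc m) * ∣ g 1 (suc m) ∣ ≤ q 2
m²*∣g₁∣≤2 m = begin
  y * y * ∣ g 1 (suc m) ∣             ≤⟨ *-monoʳ-≤ (0≤∣p∣ (g 1 (suc m))) y²≤∣d∣ ⟩
  ∣d∣ 0 (suc m) * ∣ g 1 (suc m) ∣     ≡⟨ ∣g-suc∣ 0 (suc m) ⟩
  c 0 * ∣ g 0 (suc m) ∣
    ≡⟨ cong₂ (λ z t → q 4 * ((1ℚ + z) * (1ℚ + z)) * ∣ t ∣) ι-0 (g-zero (suc m)) ⟩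
  q 4 * ∣ ½ * sgn (suc m) ∣
    ≡⟨ cong (q 4 *_) (trans (∣p*q∣≡∣p∣*∣q∣ ½ (sgn (suc m))) (cong (½ *_) (∣-1^k∣ (suc m)))) ⟩
  q 2                                 ∎
  where
  open ≤-Reasoning
  y = ι (suc m)
  y²≤∣d∣ : y * y ≤ ∣d∣ 0 (suc m)
  y²≤∣d∣ = begin
    y * y                    ≡⟨ cong₂ _*_ (ι-suc m) (ι-suc m) ⟩
    (1ℚ + ι m) * (1ℚ + ι m)  ≤⟨ ≡+⇒≤ (q 2 + q 6 * ι m + q 3 * (ι m * ι m))
        (0≤+ (0≤+ (0≤q 2) (0≤* (0≤q 6) (0≤ι m))) (0≤* (0≤q 3) (0≤* (0≤ι m) (0≤ι m))))
        (solve 1 (λ y → :- ((con 1ℚ :+ con 0ℚ :- ((con 1ℚ :+ y) :+ (con 1ℚ :+ y))) :*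
          (con 1ℚ :+ con 0ℚ :+ ((con 1ℚ :+ y) :+ (con 1ℚ :+ y))))
          := (con 1ℚ :+ y) :* (con 1ℚ :+ y) :+ (con (q 2) :+ con (q 6) :* y :+ con (q 3) :* (y :* y)))
            refl (ι m)) ⟩
    - d 0ℚ (1ℚ + ι m)        ≡⟨ cong₂ (λ x y → - d x y) ι-0 (ι-suc m) ⟨
    - d (ι 0) y              ≤⟨ p≤∣p∣ _ ⟩
    ∣ - d (ι 0) y ∣          ≡⟨ ∣-p∣≡∣p∣ (d (ι 0) y) ⟩
    ∣d∣ 0 (suc m)            ∎

-- `γ` decays geometrically, so the weight k² leaves it bounded.
k²∣γ∣ : ℕ → ℚ
k²∣γ∣ k = ι k * ι k * ∣ γ k ∣

-- The offset 6 is where 64 (1 + k)⁴ ≤ 3 (1 + 6k)(5 + 6k) k² sets in.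
k²∣γ∣-antitone : ∀ j → k²∣γ∣ (suc (6 ℕ.+ j)) ≤ k²∣γ∣ (6 ℕ.+ j)
k²∣γ∣-antitone j = *-cancelˡ-≤ 0<B (begin
  B * (ι (suc k) * ι (suc k) * ∣ γ (suc k) ∣)   ≡⟨ cong (λ z → B * (z * z * ∣ γ (suc k) ∣)) (ι-suc k) ⟩
  B * (v * v * ∣ γ (suc k) ∣)
    ≡⟨ solve 3 (λ B v g → B :* (v :* v :* g) := v :* v :* (B :* g)) refl B v ∣ γ (suc k) ∣ ⟩
  v * v * (B * ∣ γ (suc k) ∣)                   ≡⟨ cong (v * v *_) step ⟩
  v * v * (q 64 * (v * v) * ∣ γ k ∣)            ≡⟨ *-assoc (v * v) (q 64 * (v * v)) ∣ γ k ∣ ⟨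
  v * v * (q 64 * (v * v)) * ∣ γ k ∣            ≤⟨ *-monoʳ-≤ (0≤∣p∣ (γ k)) poly ⟩
  B * (y * y) * ∣ γ k ∣                         ≡⟨ *-assoc B (y * y) ∣ γ k ∣ ⟩
  B * (y * y * ∣ γ k ∣)                         ∎)
  where
  open ≤-Reasoning
  k = 6 ℕ.+ j
  y = ι k
  z = ι j
  v = 1ℚ + y
  B = q 3 * (1+6 y * 5+6 y)
  0<B : 0ℚ < B
  0<B = 0<* {q 3} (positive⁻¹ (q 3)) (0<* (0<1+ (0≤* (0≤q 6) (0≤ι k)))
    (+-mono-<-≤ {0ℚ} {q 5} (positive⁻¹ (q 5)) (0≤* (0≤q 6) (0≤ι k))))
  step : B * ∣ γ (suc k) ∣ ≡ q 64 * (v * v) * ∣ γ k ∣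
  step = begin-equality
    B * ∣ γ (suc k) ∣               ≡⟨ cong (_* ∣ γ (suc k) ∣) (0≤p⇒∣p∣≡p (<⇒≤ 0<B)) ⟨
    ∣ B ∣ * ∣ γ (suc k) ∣           ≡⟨ ∣p*q∣≡∣p∣*∣q∣ B (γ (suc k)) ⟨
    ∣ B * γ (suc k) ∣               ≡⟨ cong ∣_∣ (γ-suc k) ⟩
    ∣ q 64 * (v * v) * γ k ∣        ≡⟨ ∣p*q∣≡∣p∣*∣q∣ (q 64 * (v * v)) (γ k) ⟩
    ∣ q 64 * (v * v) ∣ * ∣ γ k ∣
      ≡⟨ cong (_* ∣ γ k ∣) (0≤p⇒∣p∣≡p (0≤* (0≤q 64) (0≤* (<⇒≤ (0<1+ (0≤ι k))) (<⇒≤ (0<1+ (0≤ι k)))))) ⟩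
    q 64 * (v * v) * ∣ γ k ∣        ∎
  -- The difference of the two sides of `poly`, expanded at `k = 6 + j`: all coefficients are
  -- positive.
  rest : ℚ
  rest = q 44 * (z * z * (z * z)) + q 908 * (z * z * z) + q 6471 * (z * z) + q 17348 * z + q 10172
  0≤z = 0≤ι j
  0≤rest : 0ℚ ≤ rest
  0≤rest = 0≤+ (0≤+ (0≤+
    (0≤+ (0≤* (0≤q 44) (0≤* (0≤* 0≤z 0≤z) (0≤* 0≤z 0≤z))) (0≤* (0≤q 908) (0≤* (0≤* 0≤z 0≤z) 0≤z)))
    (0≤* (0≤q 6471) (0≤* 0≤z 0≤z))) (0≤* (0≤q 17348) 0≤z)) (0≤q 10172)
  poly : v * v * (q 64 * (v * v)) ≤ B * (y * y)
  poly = ≡+⇒≤ rest 0≤rest (subst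
    (λ y → q 3 * (1+6 y * 5+6 y) * (y * y) ≡ (1ℚ + y) * (1ℚ + y) * (q 64 * ((1ℚ + y) * (1ℚ + y))) + rest)
    (sym (trans (ι-+ 6 j) (cong (_+ z) (ι≡ 6))))
    (solve 1 (λ z → let y = con (q 6) :+ z ; v = con 1ℚ :+ y in
      con (q 3) :* ((con 1ℚ :+ con (q 6) :* y) :* (con (q 5) :+ con (q 6) :* y)) :* (y :* y)
      := v :* v :* (con (q 64) :* (v :* v)) :+
        (con (q 44) :* (z :* z :* (z :* z)) :+ con (q 908) :* (z :* z :* z) :+ con (q 6471) :*
          (z :* z) :+ con (q 17348) :* z :+ con (q 10172)))
      refl z))

k²∣γ∣-bounded : ∀ j → k²∣γ∣ (6 ℕ.+ j) ≤ k²∣γ∣ 6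
k²∣γ∣-bounded zero    = ≤-refl
k²∣γ∣-bounded (suc j) = ≤-trans (k²∣γ∣-antitone j) (k²∣γ∣-bounded j)

C : ℚ
C = q 2 * (q 2 + k²∣γ∣ 6)

0≤C : 0ℚ ≤ C
0≤C = 0≤* (0≤q 2) (0≤+ (0≤q 2) (0≤* (0≤* (0≤ι 6) (0≤ι 6)) (0≤∣p∣ (γ 6))))

-- There are `2K` terms, each O(1/K²) by the bounds at both ends of the valley, so `e` is O(1/K).
K*∣e∣≤C : ∀ k → k²∣γ∣ (suc k) ≤ k²∣γ∣ 6 → ι (suc k) * ∣ e (suc k ℕ.* 2) (suc k) ∣ ≤ C
K*∣e∣≤C k γ≤ = begin
  y * ∣ e (K ℕ.* 2) K ∣
    ≤⟨ *-monoˡ-≤ (0≤ι K) (∣e∣≤ (K ℕ.* 2) K (∣g∣≤ends (K ℕ.* 2) K)) ⟩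
  y * (ι (K ℕ.* 2) * (G + Γ))               ≡⟨ cong (λ x → y * (x * (G + Γ))) (ι-double K) ⟩
  y * ((y + y) * (G + Γ))
    ≡⟨ solve 3 (λ y G Γ → y :* ((y :+ y) :* (G :+ Γ))
      := con (q 2) :* (y :* y :* G :+ y :* y :* Γ)) refl y G Γ ⟩
  q 2 * (y * y * G + y * y * Γ)             ≤⟨ *-monoˡ-≤ (0≤q 2) (+-mono-≤ (m²*∣g₁∣≤2 k) γ≤) ⟩
  C                                         ∎
  where
  open ≤-Reasoning
  K = suc k
  y = ι K
  G = ∣ g 1 K ∣
  Γ = ∣ γ K ∣

-- Obtained from `tail N = 2 / (N + 1)`; dividing by `1 + p` instead of `p` covers `p = 0`.
archimedean : ∀ p ε → 0ℚ ≤ p → 0ℚ < ε → ∃[ N ] p ≤ ι (suc N) * ε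
archimedean p ε 0≤p 0<ε = bound
  (tail→0 (1/p′ * ε) (0<* (positive⁻¹ 1/p′ {{1/pos⇒pos p′ {{positive 0<p′}}}}) 0<ε))
  where
  open ≤-Reasoning
  p′ = 1ℚ + p
  0<p′ : 0ℚ < p′
  0<p′ = 0<1+ 0≤p
  1/p′ = (1/ p′) {{≢-nonZero (>0⇒≢0 0<p′)}}
  bound : ∃[ N ] tail N < 1/p′ * ε → ∃[ N ] p ≤ ι (suc N) * ε
  bound (N , tailN<) = N , (begin
    p                                  ≤⟨ p≤q+p {p} {1ℚ + (1ℚ + p)} (<⇒≤ (0<1+ (<⇒≤ 0<p′))) ⟩
    1ℚ + (1ℚ + p) + p
      ≡⟨ solve 1 (λ p → con 1ℚ :+ (con 1ℚ :+ p) :+ p := (con 1ℚ :+ p) :* con (q 2)) refl p ⟩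
    p′ * q 2                           ≡⟨ cong (p′ *_) (trans (/*ι 2 (suc N)) (ι≡ 2)) ⟨
    p′ * (tail N * ι (suc N))          ≤⟨ *-monoˡ-≤ (<⇒≤ 0<p′) (*-monoʳ-≤ (0≤ι (suc N)) (<⇒≤ tailN<)) ⟩
    p′ * (1/p′ * ε * ι (suc N))        ≡⟨ cong (p′ *_) (*-assoc 1/p′ ε (ι (suc N))) ⟩
    p′ * (1/p′ * (ε * ι (suc N)))      ≡⟨ p*[1/p*r]≡r p′ (ε * ι (suc N)) {{≢-nonZero (>0⇒≢0 0<p′)}} ⟩
    ε * ι (suc N)                      ≡⟨ *-comm ε (ι (suc N)) ⟩
    ι (suc N) * ε                      ∎)

e→0 : ∀ ε → 0ℚ < ε → ∃[ N ] (∀ n → N ℕ.≤ n → ∣ e (n ℕ.* 2) n ∣ ≤ ε)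
e→0 ε 0<ε = let N , C≤ = archimedean C ε 0≤C 0<ε in 6 ℕ.+ N , bound N C≤
  where
  open ≤-Reasoning
  bound : ∀ N → C ≤ ι (suc N) * ε → ∀ n → 6 ℕ.+ N ℕ.≤ n → ∣ e (n ℕ.* 2) n ∣ ≤ ε
  bound N C≤ n@(suc k) ≤n = *-cancelˡ-≤ 0<n (begin
    ι n * ∣ e (n ℕ.* 2) n ∣   ≤⟨ K*∣e∣≤C k γ≤ ⟩
    C                         ≤⟨ C≤ ⟩
    ι (suc N) * ε
      -- Uses `suc N ≤ 6 + N ≤ n`.
      ≤⟨ *-monoʳ-≤ (<⇒≤ 0<ε) (ι-mono-≤ (ℕ.≤-trans (ℕ.+-monoˡ-≤ N (ℕ.s≤s (ℕ.z≤n {5}))) ≤n)) ⟩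
    ι n * ε                   ∎)
    where
    0<n : 0ℚ < ι n
    0<n = subst (0ℚ <_) (sym (ι-suc k)) (0<1+ (0≤ι k))
    γ≤ : k²∣γ∣ n ≤ k²∣γ∣ 6
    γ≤ = subst (λ n → k²∣γ∣ n ≤ k²∣γ∣ 6) (ℕ.m+[n∸m]≡n (ℕ.m+n≤o⇒m≤o 6 ≤n)) (k²∣γ∣-bounded (n ℕ.∸ 6))

-- Passage to the limit

∑<-cong-* : ∀ {f f′} a → (∀ k → f k ≡ a * f′ k) → ∀ n → ∑< n f ≡ a * ∑< n f′
∑<-cong-* a f≡ zero    = sym (*-zeroʳ a)
∑<-cong-* {f} {f′} a f≡ (suc n) = trans (cong₂ _+_ (∑<-cong-* a f≡ n) (f≡ n))
  (sym (*-distribˡ-+ a (∑< n f′) (f′ n)))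

∑summand : ∀ n → ∑< n summand ≡ - (+ 120 / 1) * β4-partial n + - (+ 15 / 2) * e (n ℕ.* 2) n
∑summand n = begin
  ∑< n summand                                    ≡⟨ ∑<-cong-* (- (+ 15 / 2)) summand≡u n ⟩
  - (+ 15 / 2) * ∑< n u                           ≡⟨ cong (- (+ 15 / 2) *_) (∑u n) ⟩
  - (+ 15 / 2) * (∑< n (F 0) + E)
    ≡⟨ cong (λ z → - (+ 15 / 2) * (z + E)) (∑<-cong-* (q 16) F0≡β4 n) ⟩
  - (+ 15 / 2) * (q 16 * β4-partial n + E)
    ≡⟨ solve 2 (λ b e → con (- (+ 15 / 2)) :* (con (q 16) :* b :+ e)
      := con (- (+ 120 / 1)) :* b :+ con (- (+ 15 / 2)) :* e) refl (β4-partial n) E ⟩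
  - (+ 120 / 1) * β4-partial n + - (+ 15 / 2) * E ∎
  where
  open ≡-Reasoning
  E = e (n ℕ.* 2) n

theorem1p5 : summand HasSum ((- (+ 120 / 1)) • β4)
theorem1p5 ε 0<ε =
  let N₁ , cauchy = isCauchy ((- (+ 120 / 1)) • β4) η 0<η
      -- The factor `2/15` undoes the `15/2` in front of `e`.
      N₂ , e≤     = e→0 (+ 2 / 15 * η) (0<* (positive⁻¹ (+ 2 / 15)) 0<η)
  in N₁ ℕ.⊔ N₂ , λ n ≤n → ½ * ε , 0<½ε 0<ε , N₁ , λ j ≤j →
     close n j (cauchy n j (ℕ.m⊔n≤o⇒m≤o N₁ N₂ ≤n) ≤j) (e≤ n (ℕ.m⊔n≤o⇒n≤o N₁ N₂ ≤n))
  where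
  open ≤-Reasoning
  -- Half of `ε` is the gap demanded by `<ᴿ`; the other half is shared equally by the Cauchy
  -- distance of `x n` from `x j` and the error term.
  η : ℚ
  η = ½ * (½ * ε)
  0<η : 0ℚ < η
  0<η = 0<½ε (0<½ε 0<ε)
  x : ℕ → ℚ
  x n = - (+ 120 / 1) * β4-partial n
  close : ∀ n j → ∣ x n - x j ∣ < η → ∣ e (n ℕ.* 2) n ∣ ≤ + 2 / 15 * η →
          ∣ ∑< n summand - x j ∣ + ½ * ε ≤ ε
  close n j x< e≤ = begin
    ∣ ∑< n summand - x j ∣ + ½ * ε      ≡⟨ cong (λ s → ∣ s - x j ∣ + ½ * ε) (∑summand n) ⟩
    ∣ x n + z - x j ∣ + ½ * ε
      ≡⟨ cong (λ s → ∣ s ∣ + ½ * ε) (solve 3 (λ x y z → x :+ z :- y := x :- y :+ z) refl (x n) (x j) z) ⟩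
    ∣ x n - x j + z ∣ + ½ * ε           ≤⟨ +-monoˡ-≤ (½ * ε) (∣p+q∣≤∣p∣+∣q∣ (x n - x j) z) ⟩
    ∣ x n - x j ∣ + ∣ z ∣ + ½ * ε
      ≡⟨ cong (λ s → ∣ x n - x j ∣ + s + ½ * ε) (∣p*q∣≡∣p∣*∣q∣ (- (+ 15 / 2)) E) ⟩
    ∣ x n - x j ∣ + + 15 / 2 * ∣ E ∣ + ½ * ε
      ≤⟨ +-monoˡ-≤ (½ * ε) (+-mono-≤ (<⇒≤ x<) (*-monoˡ-≤ {+ 15 / 2} (nonNegative⁻¹ (+ 15 / 2)) e≤)) ⟩
    η + + 15 / 2 * (+ 2 / 15 * η) + ½ * ε
      ≡⟨ solve 1 (λ ε → con ½ :* (con ½ :* ε) :+ con (+ 15 / 2) :*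
        (con (+ 2 / 15) :* (con ½ :* (con ½ :* ε))) :+ con ½ :* ε
        := ε) refl ε ⟩
    ε ∎
    where
    E z : ℚ
    E = e (n ℕ.* 2) n
    z = - (+ 15 / 2) * E
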